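{- Let $n\ge 2$, $i\in[0,n]$, $\lambda\in \mathrm{P}_c^{2n}$ and $\kappa:=\mathfrak{p}^{ -1}(\lambda)\in\mathcal{C}_{2n}^c$. Then $$s_i\cdot\kappa=\begin{cases}\mathfrak{p}^{ -1}(\lambda+\epsilon_a), & \text{if } \mathrm{dg}(\kappa)\subsetneq\mathrm{dg}(s_i\cdot\kappa),\\ \mathfrak{p}^{ -1}(\lambda-\epsilon_r), & \text{if } \mathrm{dg}(\kappa)\supsetneq\mathrm{dg}(s_i\cdot\kappa),\\ \kappa, & \text{otherwise},\end{cases}$$ where $$a:=\max\{c \mid (c,d)\text{ is an addable corner of }\kappa\text{ with residue } i \text{ or } 2n-i \text{ mod } 2n,\text{ and } d-c\ge0\},$$ $$r:=\max\{c \mid (c,d)\text{ is a removable corner of }\kappa\text{ with residue } i \text{ or } 2n-i \text{ mod } 2n,\text{ and } d-c\ge0\}.$$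
   Context: **Partitions and cores.** A partition $\lambda=(\lambda_1,\dots,\lambda_{\ell(\lambda)})$ is a weakly decreasing sequence of positive integers, with $\lambda_i=0$ for $i>\ell(\lambda)$. Its Young diagram is $\mathrm{dg}(\lambda)=\{(r,c)\in\mathbb{Z}_{\ge1}^2: c\le\lambda_r\}$ (French notation: row index $r$ increases from south to north, column index from west to east). The hook length $\mathrm{hl}$ of a box is the number of boxes strictly above it in its column plus the number of boxes weakly to its right in its row. A $2n$-core is a partition with no box of hook length $2n$; $\mathcal{C}_{2n}^c$ is the set of symmetric $2n$-cores ($(i,j)\in\mathrm{dg}(\kappa)$ iff $(j,i)\in\mathrm{dg}(\kappa)$). The content of a box $(i,j)$ is $j-i$ and its residue is its content modulo $2n$. An addable (removable) corner of $\lambda$ is a box outside (inside) $\mathrm{dg}(\lambda)$ whose addition (removal) yields the diagram of a partition. **Action.** The affine Weyl group $\widetilde{C}_n$ of type C, generated by $s_0,\dots,s_n$, acts on $\mathcal{C}_{2n}^c$ by: if $\kappa$ has at least one addable corner of residue $i$, then $s_i\cdot\kappa$ is obtained by adding all addable corners of residue $i$ or $2n-i$ modulo $2n$; if $\kappa$ has at least one removable corner of residue $i$, then $s_i\cdot\kappa$ is obtained by removing all removable corners of residue $i$ or $2n-i$ modulo $2n$; otherwise $s_i\cdot\kappa=\kappa$. (It is known that this is a well-defined group action.) **Bounded partitions and the bijection $\mathfrak{p}$.** $\mathrm{P}_c^{2n}$ is the set of partitions $\lambda$ with $\lambda_1\le 2n$ and $\lambda_i>\lambda_{i+1}$ whenever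 $i<\ell(\lambda)$ and $\lambda_i\le n$. There is a (known) bijection $\mathfrak{p}:\mathcal{C}_{2n}^c\to\mathrm{P}_c^{2n}$ given by $\mathfrak{p}(\kappa)=(\lambda_1,\dots,\lambda_\ell)$, where $\ell=\#\{(i,j)\in\mathrm{dg}(\kappa): i=j\}$ and, for $b\in[1,\ell]$, $$\lambda_b=1+\#\{(b,j)\in\mathrm{dg}(\kappa): b<j,\ \mathrm{hl}(b,j)<2n\}.$$ **Notation.** $\epsilon_a$ is the finitely supported sequence with $1$ in position $a$ and $0$ elsewhere; partitions are identified with finitely supported sequences by appending zeros. $[0,n]=\{0,1,\dots,n\}$. The first two cases include the assertion that $\lambda+\epsilon_a$, respectively $\lambda-\epsilon_r$, lies in $\mathrm{P}_c^{2n}$. -}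

module Defs where

open import Data.Empty using (⊥-elim)
open import Data.Integer as ℤ using (ℤ; +_; 0ℤ; 1ℤ)
import Data.Integer.Divisibility as ℤ
open import Data.List.Base using (List; []; _∷_; length; map; filter; upTo; cartesianProduct)
open import Data.List.Relation.Unary.All using (All; []; _∷_)
open import Data.List.Relation.Unary.Linked using (Linked; []; [-]; _∷_)
open import Data.Nat
open import Data.Nat.Divisibility using (_∣?_)
open import Data.Nat.Properties
open import Data.Product using (∃-syntax; _×_; _,_; proj₁; proj₂)
open import Data.Sum using (_⊎_; inj₁; inj₂)
open import Data.Unit using (⊤; tt)
open import Function.Bundles using (_⇔_)
open import Relation.Binary.PropositionalEquality
open import Relation.Nullary using (¬_; Dec; yes; no)
open import Relation.Nullary.Decidable using (map′; _×-dec_; _⊎-dec_)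
open import Relation.Unary using (Pred; Decidable; _∈_; _∉_; _∩_; _∪_; _∖_; _≐_; ｛_｝)
open import Level using (0ℓ)

record Partition : Set where
  constructor mkPartition
  field
    parts    : List ℕ
    sorted   : Linked _≥_ parts
    positive : All (0 <_) parts

open Partition public

-- Rows, columns and positions in a sequence are all numbered from 0, so the
-- box (r , c) stands for the box usually written (r+1 , c+1).  Contents and
-- hook lengths do not depend on this choice.

nth : List ℕ → ℕ → ℕ
nth []       _       = 0
nth (x ∷ _)  zero    = x
nth (_ ∷ xs) (suc r) = nth xs r

part : Partition → ℕ → ℕ
part κ = nth (parts κ)

ℓ : Partition → ℕ
ℓ κ = length (parts κ)

Box : Set
Box = ℕ × ℕ

dg : Partition → Pred Box 0ℓ
dg κ (r , c) = c < part κ r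

dg? : ∀ κ → Decidable (dg κ)
dg? κ (r , c) = c <? part κ r

boxes : Partition → List Box
boxes κ = filter (dg? κ) (cartesianProduct (upTo (ℓ κ)) (upTo (part κ 0)))

#boxes : (κ : Partition) {P : Pred Box 0ℓ} → Decidable P → ℕ
#boxes κ P? = length (filter P? (boxes κ))

-- French notation: "above" means in a row with larger index.
hl : Partition → Box → ℕ
hl κ (r , c) = #boxes κ (λ (r′ , c′) → (r <? r′) ×-dec (c′ ≟ c))
             + #boxes κ (λ (r′ , c′) → (r′ ≟ r) ×-dec (c ≤? c′))

content : Box → ℤ
content (r , c) = + c ℤ.- + r

_≡_[mod_] : ℤ → ℤ → ℕ → Set
x ≡ y [mod m ] = + m ℤ.∣ (x ℤ.- y)

HasResidue : ℕ → ℤ → Pred Box 0ℓ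
HasResidue n i b = content b ≡ i [mod 2 * n ]

HasResidue± : ℕ → ℕ → Pred Box 0ℓ
HasResidue± n i = HasResidue n (+ i) ∪ HasResidue n (+ (2 * n) ℤ.- + i)

record SymmetricCore (n : ℕ) (κ : Partition) : Set where
  field
    symmetric : ∀ i j → (i , j) ∈ dg κ ⇔ (j , i) ∈ dg κ
    core      : ∀ b → b ∈ dg κ → hl κ b ≢ 2 * n

record BoundedPartition (n : ℕ) (μ : Partition) : Set where
  field
    bounded : part μ 0 ≤ 2 * n
    strict  : ∀ j → suc j < ℓ μ → part μ j ≤ n → part μ (suc j) < part μ j

𝔭 : ℕ → Partition → List ℕ
𝔭 n κ = map row (upTo (#boxes κ (λ (i , j) → i ≟ j)))
  where
  row : ℕ → ℕ
  row b = 1 + #boxes κ (λ (i , j) → (i ≟ b) ×-dec ((b <? j) ×-dec (hl κ (b , j) <? 2 * n)))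

-- 𝔭⁻¹-of n μ κ reads "κ = 𝔭⁻¹(μ)": κ is a symmetric 2n-core whose image is μ.
record 𝔭⁻¹-of (n : ℕ) (μ κ : Partition) : Set where
  field
    symmetric-core : SymmetricCore n κ
    image          : 𝔭 n κ ≡ parts μ

-- Partitions as finitely supported sequences; integer entries so that the
-- subtraction of ε is not truncated.

Seq : Set
Seq = ℕ → ℤ

seq : Partition → Seq
seq μ j = + part μ j

ε : ℕ → Seq
ε a j with a ≟ j
... | yes _ = 1ℤ
... | no  _ = 0ℤ

_⊕_ _⊖_ : Seq → Seq → Seq
(f ⊕ g) j = f j ℤ.+ g j
(f ⊖ g) j = f j ℤ.- g j

Addable : Partition → Pred Box 0ℓ
Addable κ b = b ∉ dg κ × ∃[ μ ] dg μ ≐ (dg κ ∪ ｛ b ｝)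

Removable : Partition → Pred Box 0ℓ
Removable κ b = b ∈ dg κ × ∃[ μ ] dg μ ≐ (dg κ ∖ ｛ b ｝)

AddableRow : ℕ → ℕ → Partition → Pred ℕ 0ℓ
AddableRow n i κ c = ∃[ d ] (c , d) ∈ Addable κ × (c , d) ∈ HasResidue± n i × 0ℤ ℤ.≤ content (c , d)

RemovableRow : ℕ → ℕ → Partition → Pred ℕ 0ℓ
RemovableRow n i κ c = ∃[ d ] (c , d) ∈ Removable κ × (c , d) ∈ HasResidue± n i × 0ℤ ℤ.≤ content (c , d)

IsMax : Pred ℕ 0ℓ → Pred ℕ 0ℓ
IsMax P m = m ∈ P × (∀ c → c ∈ P → c ≤ m)

HasResidue? : ∀ n i → Decidable (HasResidue n i)
HasResidue? n i b = 2 * n ∣? ℤ.∣ content b ℤ.- i ∣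

HasResidue±? : ∀ n i → Decidable (HasResidue± n i)
HasResidue±? n i b = HasResidue? n (+ i) b ⊎-dec HasResidue? n (+ (2 * n) ℤ.- + i) b

nth-antitone : ∀ {xs} → Linked _≥_ xs → ∀ r → nth xs (suc r) ≤ nth xs r
nth-antitone []        _       = z≤n
nth-antitone [-]       _       = z≤n
nth-antitone (x≥y ∷ _) zero    = x≥y
nth-antitone (_ ∷ ys)  (suc r) = nth-antitone ys r

part-antitone : ∀ κ r → part κ (suc r) ≤ part κ r
part-antitone κ = nth-antitone (sorted κ)

nth-zero : ∀ xs {r} → length xs ≤ r → nth xs r ≡ 0
nth-zero []       _         = refl
nth-zero (_ ∷ xs) (s≤s p) = nth-zero xs p

fromSeq : (f : ℕ → ℕ) → (∀ r → f (suc r) ≤ f r) → ∀ N → f N ≡ 0 →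
          ∃[ μ ] ∀ r → part μ r ≡ f r
fromSeq f anti N fN≡0 with f 0 in f0
... | zero = mkPartition [] [] [] , λ r → sym (n≤0⇒n≡0 (≤-trans (≤f0 r) (≤-reflexive f0)))
  where
  ≤f0 : ∀ r → f r ≤ f 0
  ≤f0 zero    = ≤-refl
  ≤f0 (suc r) = ≤-trans (anti r) (≤f0 r)
fromSeq f anti zero    fN≡0 | suc x with () ← trans (sym f0) fN≡0
fromSeq f anti (suc N) fN≡0 | suc x
  with mkPartition ys s p , eq ← fromSeq (λ r → f (suc r)) (λ r → anti (suc r)) N fN≡0
  = mkPartition (suc x ∷ ys) (cons ys s (eq 0)) (s≤s z≤n ∷ p) , λ where
      zero    → sym f0
      (suc r) → eq r
  where
  cons : ∀ ys → Linked _≥_ ys → nth ys 0 ≡ f 1 → Linked _≥_ (suc x ∷ ys)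
  cons []       _ _  = [-]
  cons (y ∷ ys) s y≡ = subst₂ _≤_ (sym y≡) f0 (anti 0) ∷ s

-- The addable corner in row r, if there is one, is (r , part κ r); the
-- removable one is (r , part κ r ∸ 1).

CanAdd : Partition → Pred ℕ 0ℓ
CanAdd κ zero    = ⊤
CanAdd κ (suc r) = part κ (suc r) < part κ r

CanRemove : Partition → Pred ℕ 0ℓ
CanRemove κ r = part κ (suc r) < part κ r

CanAdd? : ∀ κ → Decidable (CanAdd κ)
CanAdd? κ zero    = yes tt
CanAdd? κ (suc r) = part κ (suc r) <? part κ r

CanRemove? : ∀ κ → Decidable (CanRemove κ)
CanRemove? κ r = part κ (suc r) <? part κ r

CanAdd⇒≤ℓ : ∀ κ {r} → CanAdd κ r → r ≤ ℓ κ
CanAdd⇒≤ℓ κ {zero}  _ = z≤n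
CanAdd⇒≤ℓ κ {suc r} p with suc r ≤? ℓ κ
... | yes q = q
... | no ¬q with () ← subst (part κ (suc r) <_) (nth-zero (parts κ) (≤-pred (≰⇒> ¬q))) p

CanRemove⇒<ℓ : ∀ κ {r} → CanRemove κ r → r < ℓ κ
CanRemove⇒<ℓ κ = CanAdd⇒≤ℓ κ

indicator : {A : Set} → Dec A → ℕ
indicator (yes _) = 1
indicator (no  _) = 0

addRows : ∀ κ {Q : Pred ℕ 0ℓ} (Q? : Decidable Q) → (∀ {r} → Q r → CanAdd κ r) →
          ∃[ μ ] ∀ r → part μ r ≡ part κ r + indicator (Q? r)
addRows κ Q? ok = fromSeq f anti (suc (ℓ κ)) f≡0
  where
  f : ℕ → ℕ
  f r = part κ r + indicator (Q? r)
  anti : ∀ r → f (suc r) ≤ f r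
  anti r with Q? (suc r)
  ... | yes q = ≤-trans (≤-trans (≤-reflexive (+-comm _ 1)) (ok q)) (m≤m+n _ _)
  ... | no  _ = ≤-trans (≤-trans (≤-reflexive (+-identityʳ _)) (part-antitone κ r)) (m≤m+n _ _)
  f≡0 : f (suc (ℓ κ)) ≡ 0
  f≡0 with Q? (suc (ℓ κ))
  ... | yes q = ⊥-elim (<-irrefl refl (CanAdd⇒≤ℓ κ (ok q)))
  ... | no  _ = trans (+-identityʳ _) (nth-zero (parts κ) (n≤1+n _))

removeRows : ∀ κ {Q : Pred ℕ 0ℓ} (Q? : Decidable Q) → (∀ {r} → Q r → CanRemove κ r) →
             ∃[ μ ] ∀ r → part μ r ≡ part κ r ∸ indicator (Q? r)
removeRows κ Q? ok = fromSeq f anti (ℓ κ) f≡0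
  where
  f : ℕ → ℕ
  f r = part κ r ∸ indicator (Q? r)
  anti : ∀ r → f (suc r) ≤ f r
  anti r with Q? r
  ... | yes q = ≤-trans (m∸n≤m _ (indicator (Q? (suc r)))) (∸-monoˡ-≤ 1 (ok q))
  ... | no  _ = ≤-trans (m∸n≤m _ (indicator (Q? (suc r)))) (part-antitone κ r)
  f≡0 : f (ℓ κ) ≡ 0
  f≡0 = trans (cong (_∸ indicator (Q? (ℓ κ))) (nth-zero (parts κ) ≤-refl)) (0∸n≡0 (indicator (Q? (ℓ κ))))

addRows-dg : ∀ κ {Q : Pred ℕ 0ℓ} (Q? : Decidable Q) μ →
             (∀ r → part μ r ≡ part κ r + indicator (Q? r)) →
             dg μ ≐ (dg κ ∪ (λ (r , c) → Q r × c ≡ part κ r))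
addRows-dg κ {Q} Q? μ eq = (λ {b} → to b) , (λ {b} → from b)
  where
  to : ∀ b → b ∈ dg μ → b ∈ dg κ ⊎ (Q (proj₁ b) × proj₂ b ≡ part κ (proj₁ b))
  to (r , c) c< with Q? r | eq r
  ... | no  _ | e = inj₁ (subst (c <_) (trans e (+-identityʳ _)) c<)
  ... | yes q | e with m≤n⇒m<n∨m≡n (≤-pred (subst (c <_) (trans e (+-comm _ 1)) c<))
  ...   | inj₁ p = inj₁ p
  ...   | inj₂ p = inj₂ (q , p)
  from : ∀ b → b ∈ dg κ ⊎ (Q (proj₁ b) × proj₂ b ≡ part κ (proj₁ b)) → b ∈ dg μ
  from (r , c) (inj₁ p) = subst (c <_) (sym (eq r)) (≤-trans p (m≤m+n _ _))
  from (r , c) (inj₂ (q , refl)) with Q? r | eq r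
  ... | yes _ | e = ≤-reflexive (sym (trans e (+-comm _ 1)))
  ... | no ¬q | _ = ⊥-elim (¬q q)

removeRows-dg : ∀ κ {Q : Pred ℕ 0ℓ} (Q? : Decidable Q) → (∀ {r} → Q r → CanRemove κ r) → ∀ μ →
                (∀ r → part μ r ≡ part κ r ∸ indicator (Q? r)) →
                dg μ ≐ (dg κ ∖ (λ (r , c) → Q r × suc c ≡ part κ r))
removeRows-dg κ {Q} Q? ok μ eq = (λ {b} → to b) , (λ {b} → from b)
  where
  to : ∀ b → b ∈ dg μ → b ∈ dg κ × ¬ (Q (proj₁ b) × suc (proj₂ b) ≡ part κ (proj₁ b))
  to (r , c) c< = ≤-trans c<κ∸ (m∸n≤m _ (indicator (Q? r))) , not
    where
    c<κ∸ : c < part κ r ∸ indicator (Q? r)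
    c<κ∸ = subst (c <_) (eq r) c<
    not : ¬ (Q r × suc c ≡ part κ r)
    not (q , e) with Q? r | c<κ∸
    ... | yes _ | p = <-irrefl refl (subst (λ x → c < x ∸ 1) (sym e) p)
    ... | no ¬q | _ = ¬q q
  from : ∀ b → b ∈ dg κ × ¬ (Q (proj₁ b) × suc (proj₂ b) ≡ part κ (proj₁ b)) → b ∈ dg μ
  from (r , c) (c< , not) with Q? r | eq r
  ... | no  _ | e = subst (c <_) (sym e) c<
  ... | yes q | e with m≤n⇒m<n∨m≡n c<
  ...   | inj₁ p = subst (c <_) (sym e) (∸-monoˡ-≤ 1 p)
  ...   | inj₂ p = ⊥-elim (not (q , p))

Addable⇒ : ∀ κ {r c} → Addable κ (r , c) → CanAdd κ r × c ≡ part κ r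
Addable⇒ κ {r} {c} (∉κ , μ , to , from) = can r refl , c≡
  where
  c∈μ : c < part μ r
  c∈μ = from {r , c} (inj₂ refl)
  c≡ : c ≡ part κ r
  c≡ with m≤n⇒m<n∨m≡n (≮⇒≥ ∉κ)
  ... | inj₂ e = sym e
  ... | inj₁ p with to {r , part κ r} (<-trans p c∈μ)
  ...   | inj₁ q = ⊥-elim (<-irrefl refl q)
  ...   | inj₂ e = cong proj₂ e
  can : ∀ r′ → r ≡ r′ → CanAdd κ r′
  can zero     _    = tt
  can (suc r′) refl with to {r′ , c} (≤-trans c∈μ (part-antitone μ r′))
  ... | inj₁ q = subst (_< part κ r′) c≡ q
  ... | inj₂ e = ⊥-elim (1+n≢n (cong proj₁ e))

Addable⇐ : ∀ κ {r c} → CanAdd κ r × c ≡ part κ r → Addable κ (r , c)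
Addable⇐ κ {r} {c} (can , refl)
  with μ , eq ← addRows κ (r ≟_) (λ { refl → can })
  with to , from ← addRows-dg κ (r ≟_) μ eq
  = <-irrefl refl , μ , (λ {b} → to′ b) , (λ {b} → from′ b)
  where
  to′ : ∀ b → b ∈ dg μ → b ∈ dg κ ⊎ (r , part κ r) ≡ b
  to′ b b∈ with to {b} b∈
  ... | inj₁ p             = inj₁ p
  ... | inj₂ (refl , refl) = inj₂ refl
  from′ : ∀ b → b ∈ dg κ ⊎ (r , part κ r) ≡ b → b ∈ dg μ
  from′ b (inj₁ p)    = from {b} (inj₁ p)
  from′ b (inj₂ refl) = from {b} (inj₂ (refl , refl))

Removable⇒ : ∀ κ {r c} → Removable κ (r , c) → CanRemove κ r × suc c ≡ part κ r
Removable⇒ κ {r} {c} (∈κ , μ , to , from) = can , c≡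
  where
  ∉μ : ¬ (c < part μ r)
  ∉μ p = proj₂ (to {r , c} p) refl
  c≡ : suc c ≡ part κ r
  c≡ with m≤n⇒m<n∨m≡n ∈κ
  ... | inj₂ e = e
  ... | inj₁ p = ⊥-elim (∉μ (<-trans ≤-refl (from {r , suc c} (p , λ e → 1+n≢n (sym (cong proj₂ e))))))
  can : part κ (suc r) < part κ r
  can with part κ (suc r) <? part κ r
  ... | yes p = p
  ... | no ¬p = ⊥-elim (∉μ (≤-trans
          (from {suc r , c} (≤-trans ∈κ (≮⇒≥ ¬p) , λ e → 1+n≢n (sym (cong proj₁ e))))
          (part-antitone μ r)))

Removable⇐ : ∀ κ {r c} → CanRemove κ r × suc c ≡ part κ r → Removable κ (r , c)
Removable⇐ κ {r} {c} (can , e)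
  with μ , eq ← removeRows κ (r ≟_) (λ { refl → can })
  with to , from ← removeRows-dg κ (r ≟_) (λ { refl → can }) μ eq
  = ≤-reflexive e , μ , (λ {b} → to′ b) , (λ {b} → from′ b)
  where
  to′ : ∀ b → b ∈ dg μ → b ∈ dg κ × ¬ ((r , c) ≡ b)
  to′ b b∈ with p , not ← to {b} b∈ = p , λ { refl → not (refl , e) }
  from′ : ∀ b → b ∈ dg κ × ¬ ((r , c) ≡ b) → b ∈ dg μ
  from′ b (p , not) = from {b} (p , λ { (refl , e′) → not (cong (r ,_) (suc-injective (trans e (sym e′)))) })

module _ (κ : Partition) {P : Pred Box 0ℓ} (P? : Decidable P) where

  private
    A? : ∀ r → Dec (CanAdd κ r × P (r , part κ r))
    A? r = CanAdd? κ r ×-dec P? (r , part κ r)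

    R? : ∀ r → Dec (CanRemove κ r × P (r , pred (part κ r)))
    R? r = CanRemove? κ r ×-dec P? (r , pred (part κ r))

  someAddable? : Dec (∃[ b ] b ∈ Addable κ × b ∈ P)
  someAddable? = map′
    (λ (r , _ , can , p) → (r , part κ r) , Addable⇐ κ (can , refl) , p)
    (λ ((r , c) , add , p) → let can , e = Addable⇒ κ add in
       r , s≤s (CanAdd⇒≤ℓ κ can) , can , subst (λ x → P (r , x)) e p)
    (anyUpTo? A? (suc (ℓ κ)))

  someRemovable? : Dec (∃[ b ] b ∈ Removable κ × b ∈ P)
  someRemovable? = map′
    (λ (r , _ , can , p) → (r , pred (part κ r)) ,
       Removable⇐ κ (can , suc-pred _ {{>-nonZero (≤-trans (s≤s z≤n) can)}}) , p)
    (λ ((r , c) , rem , p) → let can , e = Removable⇒ κ rem in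
       r , CanRemove⇒<ℓ κ can , can , subst (λ x → P (r , x)) (cong pred e) p)
    (anyUpTo? R? (ℓ κ))

  addCorners : ∃[ μ ] dg μ ≐ (dg κ ∪ (Addable κ ∩ P))
  addCorners
    with μ , eq ← addRows κ A? proj₁
    with to , from ← addRows-dg κ A? μ eq
    = μ , (λ {b} → to′ b) , (λ {b} → from′ b)
    where
    to′ : ∀ b → b ∈ dg μ → b ∈ dg κ ⊎ (b ∈ Addable κ × b ∈ P)
    to′ b b∈ with to {b} b∈
    ... | inj₁ p                  = inj₁ p
    ... | inj₂ ((can , p) , refl) = inj₂ (Addable⇐ κ (can , refl) , p)
    from′ : ∀ b → b ∈ dg κ ⊎ (b ∈ Addable κ × b ∈ P) → b ∈ dg μ
    from′ b (inj₁ p) = from {b} (inj₁ p)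
    from′ b (inj₂ (add , p)) with Addable⇒ κ add
    ... | can , refl = from {b} (inj₂ ((can , p) , refl))

  removeCorners : ∃[ μ ] dg μ ≐ (dg κ ∖ (Removable κ ∩ P))
  removeCorners
    with μ , eq ← removeRows κ R? proj₁
    with to , from ← removeRows-dg κ R? proj₁ μ eq
    = μ , (λ {b} → to′ b) , (λ {b} → from′ b)
    where
    to′ : ∀ b → b ∈ dg μ → b ∈ dg κ × ¬ (b ∈ Removable κ × b ∈ P)
    to′ (r , c) b∈ with p , not ← to {r , c} b∈ = p , λ (rem , q) →
      let can , e = Removable⇒ κ rem in
      not ((can , subst (λ x → P (r , x)) (cong pred e) q) , e)
    from′ : ∀ b → b ∈ dg κ × ¬ (b ∈ Removable κ × b ∈ P) → b ∈ dg μ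
    from′ (r , c) (p , not) = from {r , c} (p , λ ((can , q) , e) →
      not (Removable⇐ κ (can , e) , subst (λ x → P (r , x)) (sym (cong pred e)) q))

-- A 2n-core never has both an addable and a removable corner of residue i,
-- so on symmetric 2n-cores the order of the first two tests is immaterial.
s : ℕ → ℕ → Partition → Partition
s n i κ with someAddable? κ (HasResidue? n (+ i)) | someRemovable? κ (HasResidue? n (+ i))
... | yes _ | _     = proj₁ (addCorners κ (HasResidue±? n i))
... | no  _ | yes _ = proj₁ (removeCorners κ (HasResidue±? n i))
... | no  _ | no  _ = κ

{-# OPTIONS --safe #-}

-- Encode κ by the contents β r = κ r − r of the first boxes outside its rows
-- (its beads). For symmetric κ the box (r , c) lies in κ iff β r + β c ≥ 1, the
-- sum is never 1, and the hook length is β r + β c − 1; so the 2n-core condition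
-- says that no sum is 2n + 1. If h b is the number of beads ≥ 2n + 1 − β b, then
-- λ b = (1 + κ b) ∸ max (1 + b) (h b) for every b, with truncated subtraction.
--
-- The map s i moves a set of beads up (or down) by one, and the moved beads are
-- congruent to ± i, hence to each other up to sign, modulo 2n; in particular the
-- sum of any two is even. In a row b that does not move, neither κ b nor h b
-- changes. In a row that moves, κ b grows by one, and h b grows by one iff
-- 2n − β b is a bead. For the least moved β b ≥ 0 such a bead, which would move
-- too, can only be ≥ β b, where the maximum with 1 + b hides it; for the other
-- moved β b ≥ 0 it exists and cancels the growth of κ b.
module Submission where

open import Defs
open import Data.Empty using (⊥; ⊥-elim)
open import Data.Integer as ℤ using (ℤ; +_; 0ℤ; 1ℤ; +≤+)
import Data.Integer.Divisibility.Signed as Signed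
import Data.Integer.Properties as ℤ
open import Data.Integer.Tactic.RingSolver using (solve)
open import Data.List.Base using ([]; _∷_; length; map; filter; upTo; applyUpTo; cartesianProduct)
open import Data.List.Membership.Propositional using () renaming (_∈_ to _∈ᴸ_)
open import Data.List.Membership.Propositional.Properties
  using (∈-filter⁺; ∈-filter⁻; ∈-cartesianProduct⁺; ∈-upTo⁺; ∈-applyUpTo⁺; ∈-applyUpTo⁻)
open import Data.List.Membership.Propositional.Properties.WithK using (unique∧set⇒bag)
open import Data.List.Properties using (length-applyUpTo; length-map; length-upTo; map-upTo)
open import Data.List.Relation.Binary.BagAndSetEquality using (∼bag⇒↭)
open import Data.List.Relation.Binary.Permutation.Propositional.Properties using (↭-length)
import Data.List.Relation.Unary.All as All
open import Data.List.Relation.Unary.All using (All)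
import Data.List.Relation.Unary.All.Properties as All
open import Data.List.Relation.Unary.Linked as Linked using (Linked)
import Data.List.Relation.Unary.Unique.Propositional.Properties as Unique
open import Data.Nat
open import Data.Nat.Properties
open import Data.Product using (∃-syntax; _×_; _,_; proj₁; proj₂)
open import Data.Sum using (_⊎_; inj₁; inj₂; [_,_]′)
open import Function.Base using (_∘_; case_of_)
open import Function.Bundles using (mk⇔; Equivalence)
open import Level using (0ℓ)
open import Relation.Binary.Definitions using (tri<; tri≈; tri>)
open import Relation.Binary.PropositionalEquality
open import Relation.Nullary using (¬_; Dec; yes; no)
open import Relation.Nullary.Decidable using (_×-dec_)
open import Relation.Unary using (Pred; Decidable; _∪_; _∩_; _∖_; _≐_; _⊂_; _⊃_)

-- Linear arithmetic over ℤ: hypotheses are added up with ⊞, and lin compares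
-- the slack of the sum with that of the goal.

infixl 6 _⊞_
_⊞_ : ∀ {a b c d} → a ℤ.≤ b → c ℤ.≤ d → a ℤ.+ c ℤ.≤ b ℤ.+ d
_⊞_ = ℤ.+-mono-≤

lin : ∀ {a b c d} → a ℤ.≤ b → b ℤ.- a ≡ d ℤ.- c → c ℤ.≤ d
lin p e = ℤ.0≤i-j⇒j≤i (subst (0ℤ ℤ.≤_) e (ℤ.i≤j⇒0≤j-i p))

lin≡ : ∀ {a b c d} → a ≡ b → b ℤ.- a ≡ d ℤ.- c → c ≡ d
lin≡ p e = ℤ.≤-antisym (lin (ℤ.≤-reflexive p) e)
  (ℤ.i-j≤0⇒i≤j (ℤ.≤-trans (ℤ.≤-reflexive (sym e)) (ℤ.i≤j⇒i-j≤0 (ℤ.≤-reflexive (sym p)))))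

1≰0 : ¬ (1ℤ ℤ.≤ 0ℤ)
1≰0 (+≤+ ())

≰⇒1+≤ : ∀ {x y} → ¬ (x ℤ.≤ y) → 1ℤ ℤ.+ y ℤ.≤ x
≰⇒1+≤ = ℤ.i<j⇒suc[i]≤j ∘ ℤ.≰⇒>

1+≤⇒≰ : ∀ {x y} → 1ℤ ℤ.+ y ℤ.≤ x → ¬ (x ℤ.≤ y)
1+≤⇒≰ {x} {y} p q = 1≰0 (lin (p ⊞ q) (solve (x ∷ y ∷ [])))

≤∧≢⇒1+≤ : ∀ {x y} → x ℤ.≤ y → x ≢ y → 1ℤ ℤ.+ x ℤ.≤ y
≤∧≢⇒1+≤ p q = ≰⇒1+≤ (λ r → q (ℤ.≤-antisym p r))

-- Counting boxes

∈-boxes : ∀ κ {b} → dg κ b → b ∈ᴸ boxes κ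
∈-boxes κ {r , c} c< = ∈-filter⁺ (dg? κ) (∈-cartesianProduct⁺ (∈-upTo⁺ r<ℓ) (∈-upTo⁺ (<-≤-trans c< (≤first r)))) c<
  where
  ≤first : ∀ r → part κ r ≤ part κ 0
  ≤first zero    = ≤-refl
  ≤first (suc r) = ≤-trans (part-antitone κ r) (≤first r)
  r<ℓ : r < ℓ κ
  r<ℓ = ≰⇒> λ ℓ≤r → case subst (c <_) (nth-zero (parts κ) ℓ≤r) c< of λ ()

-- Both lists are free of duplicates and have the same members, so one is a permutation of the
-- other.
#boxes-interval : ∀ κ {P : Pred Box 0ℓ} (P? : Decidable P) (e : ℕ → Box) → (∀ {t t′} → e t ≡ e t′ → t ≡ t′) →
  ∀ u v → (∀ {t} → u ≤ t → t < v → dg κ (e t) × P (e t)) →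
  (∀ {b} → dg κ b → P b → ∃[ t ] u ≤ t × t < v × b ≡ e t) →
  #boxes κ P? ≡ v ∸ u
#boxes-interval κ P? e inj u v inside only = trans
  (↭-length (∼bag⇒↭ (unique∧set⇒bag unique₁ unique₂ (mk⇔ to from))))
  (length-applyUpTo (e ∘ _+_ u) (v ∸ u))
  where
  unique₁ = Unique.filter⁺ P? (Unique.filter⁺ (dg? κ)
              (Unique.cartesianProduct⁺ (Unique.upTo⁺ (ℓ κ)) (Unique.upTo⁺ (part κ 0))))
  unique₂ = Unique.applyUpTo⁺₁ (e ∘ _+_ u) (v ∸ u) (λ i<j _ eq → <⇒≢ i<j (+-cancelˡ-≡ u _ _ (inj eq)))
  to : ∀ {b} → b ∈ᴸ filter P? (boxes κ) → b ∈ᴸ applyUpTo (e ∘ _+_ u) (v ∸ u)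
  to b∈ with ∈-filter⁻ P? {xs = boxes κ} b∈
  ... | b∈boxes , Pb with ∈-filter⁻ (dg? κ) {xs = cartesianProduct (upTo (ℓ κ)) (upTo (part κ 0))} b∈boxes
  ...   | _ , b∈dg with only b∈dg Pb
  ...     | t , u≤t , t<v , refl = subst (λ x → e x ∈ᴸ _) (m+[n∸m]≡n u≤t)
            (∈-applyUpTo⁺ (e ∘ _+_ u) (∸-monoˡ-< t<v u≤t))
  from : ∀ {b} → b ∈ᴸ applyUpTo (e ∘ _+_ u) (v ∸ u) → b ∈ᴸ filter P? (boxes κ)
  from b∈ with ∈-applyUpTo⁻ (e ∘ _+_ u) b∈
  ... | t , t< , refl with inside (m≤m+n u t) (subst (u + t <_) (m+[n∸m]≡n u≤v) (+-monoʳ-< u t<))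
    -- An index below `v ∸ u` exists, so this subtraction was not truncated to zero.
    where u≤v = <⇒≤ (m∸n≢0⇒n<m {v} {u} λ z → case subst (t <_) z t< of λ ())
  ...   | e∈dg , Pe = ∈-filter⁺ P? (∈-boxes κ e∈dg) Pe

-- Beads

-- Opaque, so that r can be inferred from β κ r.
opaque

  β : Partition → ℕ → ℤ
  β κ r = content (r , part κ r)

Symmetric : Partition → Set
Symmetric κ = ∀ {r c} → c < part κ r → r < part κ c

module _ (κ : Partition) where

  part-mono : ∀ {r c} → r ≤ c → part κ c ≤ part κ r
  part-mono r≤c = go (≤⇒≤′ r≤c)
    where
    go : ∀ {r c} → r ≤′ c → part κ c ≤ part κ r
    go ≤′-refl       = ≤-refl
    go (≤′-step r≤c) = ≤-trans (part-antitone κ _) (go r≤c)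

  opaque
    unfolding β

    β-drop : ∀ r d → β κ (d + r) ℤ.+ + d ℤ.≤ β κ r
    β-drop r d = arith (+ part κ (d + r)) (+ part κ r) (+ r) (+ d) (+≤+ (part-mono (m≤n+m r d)))
      where
      arith : ∀ x y r d → x ℤ.≤ y → x ℤ.- (d ℤ.+ r) ℤ.+ d ℤ.≤ y ℤ.- r
      arith x y r d x≤y = lin x≤y (solve (x ∷ y ∷ r ∷ d ∷ []))

  β-anti : ∀ {r c} → r < c → 1ℤ ℤ.+ β κ c ℤ.≤ β κ r
  β-anti {r} {c} r<c = subst (λ c → 1ℤ ℤ.+ β κ c ℤ.≤ β κ r) (m∸n+n≡m (<⇒≤ r<c))
    (arith (β κ (c ∸ r + r)) (β κ r) (+ (c ∸ r)) (+≤+ (m<n⇒0<n∸m r<c)) (β-drop r (c ∸ r)))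
    where
    arith : ∀ x y d → 1ℤ ℤ.≤ d → x ℤ.+ d ℤ.≤ y → 1ℤ ℤ.+ x ℤ.≤ y
    arith x y d p q = lin (p ⊞ q) (solve (x ∷ y ∷ d ∷ []))

  β-mono : ∀ {r c} → r ≤ c → β κ c ℤ.≤ β κ r
  β-mono r≤c with m≤n⇒m<n∨m≡n r≤c
  ... | inj₁ r<c  = ℤ.≤-trans (ℤ.i≤suc[i] _) (β-anti r<c)
  ... | inj₂ refl = ℤ.≤-refl

  β-reflects-< : ∀ {r c} → 1ℤ ℤ.+ β κ c ℤ.≤ β κ r → r < c
  β-reflects-< p = ≰⇒> (1+≤⇒≰ p ∘ β-mono)

  β-injective : ∀ {r c} → β κ r ≡ β κ c → r ≡ c
  β-injective {r} {c} eq with <-cmp r c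
  ... | tri< r<c _ _ = ⊥-elim (1+≤⇒≰ (β-anti r<c) (ℤ.≤-reflexive eq))
  ... | tri≈ _ r≡c _ = r≡c
  ... | tri> _ _ c<r = ⊥-elim (1+≤⇒≰ (β-anti c<r) (ℤ.≤-reflexive (sym eq)))

-- h beads have content at least k.
record Cut (κ : Partition) (k : ℤ) (h : ℕ) : Set where
  constructor cut
  field
    before : ∀ {j} → j < h → k ℤ.≤ β κ j
    at     : 1ℤ ℤ.+ β κ h ℤ.≤ k

module _ {κ : Partition} {k : ℤ} where

  cut-unique : ∀ {h h′} → Cut κ k h → Cut κ k h′ → h ≡ h′
  cut-unique {h} {h′} (cut before at) (cut before′ at′) with <-cmp h h′
  ... | tri< h<h′ _ _ = ⊥-elim (1+≤⇒≰ at (before′ h<h′))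
  ... | tri≈ _ h≡h′ _ = h≡h′
  ... | tri> _ _ h′<h = ⊥-elim (1+≤⇒≰ at′ (before h′<h))

  cut-≥ : ∀ {h j} → Cut κ k h → 1ℤ ℤ.+ β κ j ℤ.≤ k → h ≤ j
  cut-≥ (cut before _) p = ≮⇒≥ (1+≤⇒≰ p ∘ before)

  cut-< : ∀ {h j} → Cut κ k h → k ℤ.≤ β κ j → j < h
  cut-< (cut _ at) p = β-reflects-< κ (ℤ.≤-trans at p)

opaque
  unfolding β

  cut-exists : ∀ κ k → ∃[ h ] Cut κ k h
  cut-exists κ k = search (ℤ.∣ k ∣ + suc (part κ 0))
      (arith (β κ (ℤ.∣ k ∣ + suc (part κ 0))) (+ ℤ.∣ k ∣) k (+ part κ 0) (β-drop κ (suc (part κ 0)) ℤ.∣ k ∣)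
         (+≤+ (part-mono κ z≤n)) (k≥ k))
    where
    k≥ : ∀ k → ℤ.- (+ ℤ.∣ k ∣) ℤ.≤ k
    k≥ (+ n)        = ℤ.neg-≤-pos
    k≥ (ℤ.-[1+ n ]) = ℤ.≤-refl
    arith : ∀ x a k p {q} → x ℤ.+ a ℤ.≤ q ℤ.- (1ℤ ℤ.+ p) → q ℤ.≤ p → ℤ.- a ℤ.≤ k → 1ℤ ℤ.+ x ℤ.≤ k
    arith x a k p {q} f g h = lin (f ⊞ g ⊞ h) (solve (x ∷ a ∷ k ∷ p ∷ q ∷ []))
    search : ∀ N → 1ℤ ℤ.+ β κ N ℤ.≤ k → ∃[ h ] Cut κ k h
    search zero    at = 0 , cut (λ ()) at
    search (suc N) at with k ℤ.≤? β κ N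
    ... | yes k≤ = suc N , cut (λ { (s≤s j≤N) → ℤ.≤-trans k≤ (β-mono κ j≤N) }) at
    ... | no  k≰ = search N (≰⇒1+≤ k≰)

-- Symmetric partitions: boxes, beads and gaps

module _ (κ : Partition) (symm : Symmetric κ) where

  opaque
    unfolding β

    -- Symmetry supplies the second inequality `r < part κ c`; the row and column numbers cancel
    -- when the two are added.
    ∈dg⇒2≤sum : ∀ {r c} → c < part κ r → + 2 ℤ.≤ β κ r ℤ.+ β κ c
    ∈dg⇒2≤sum {r} {c} p = arith (+ part κ r) (+ part κ c) (+ r) (+ c) (+≤+ p) (+≤+ (symm p))
      where
      arith : ∀ x y r c → 1ℤ ℤ.+ c ℤ.≤ x → 1ℤ ℤ.+ r ℤ.≤ y → + 2 ℤ.≤ x ℤ.- r ℤ.+ (y ℤ.- c)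
      arith x y r c p q = lin (p ⊞ q) (solve (x ∷ y ∷ r ∷ c ∷ []))

  opaque
    unfolding β

    ∉dg⇒sum≤0 : ∀ {r c} → ¬ (c < part κ r) → β κ r ℤ.+ β κ c ℤ.≤ 0ℤ
    ∉dg⇒sum≤0 {r} {c} p = arith (+ part κ r) (+ part κ c) (+ r) (+ c) (+≤+ (≮⇒≥ p)) (+≤+ (≮⇒≥ (p ∘ symm)))
      where
      arith : ∀ x y r c → x ℤ.≤ c → y ℤ.≤ r → x ℤ.- r ℤ.+ (y ℤ.- c) ℤ.≤ 0ℤ
      arith x y r c p q = lin (p ⊞ q) (solve (x ∷ y ∷ r ∷ c ∷ []))

  1≤sum⇒∈dg : ∀ {r c} → 1ℤ ℤ.≤ β κ r ℤ.+ β κ c → c < part κ r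
  1≤sum⇒∈dg {r} {c} p with c <? part κ r
  ... | yes q = q
  ... | no ¬q = ⊥-elim (1≰0 (ℤ.≤-trans p (∉dg⇒sum≤0 ¬q)))

  sum≢1 : ∀ r c → β κ r ℤ.+ β κ c ≢ 1ℤ
  sum≢1 r c eq with subst (+ 2 ℤ.≤_) eq (∈dg⇒2≤sum {r} {c} (1≤sum⇒∈dg {r} {c} (ℤ.≤-reflexive (sym eq))))
  ... | +≤+ (s≤s ())

  opaque
    unfolding β

    -- The boundary of the diagram passes content `k` either at the end of a row or at the top of a
    -- column, and by symmetry column `c` is as long as row `c`.
    bead-or-gap : ∀ k → (∃[ r ] β κ r ≡ k) ⊎ (∃[ c ] β κ c ≡ 1ℤ ℤ.- k)
    bead-or-gap k with cut-exists κ (1ℤ ℤ.+ k)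
    ... | h , cut before at with β κ h ℤ.≟ k
    ...   | yes eq = inj₁ (h , eq)
    ...   | no neq = inj₂ (c , trans (cong₂ ℤ._-_ (cong +_ κc≡h) c≡) (difference k (+ h)))
      where
      κh≤ : + part κ h ℤ.≤ k ℤ.+ + h ℤ.- 1ℤ
      κh≤ = arith (+ part κ h) (+ h) k at neq
        where
        arith : ∀ x h k → 1ℤ ℤ.+ (x ℤ.- h) ℤ.≤ 1ℤ ℤ.+ k → x ℤ.- h ≢ k → x ℤ.≤ k ℤ.+ h ℤ.- 1ℤ
        arith x h k p q = lin (≤∧≢⇒1+≤ {x ℤ.- h} {k} (lin p (solve (x ∷ h ∷ k ∷ []))) q) (solve (x ∷ h ∷ k ∷ []))
      c : ℕ
      -- The `h` rows with beads above `k` reach column `k + h - 1` and row `h` does not, so this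
      -- column has exactly `h` boxes. The absolute value only converts to ℕ.
      c = ℤ.∣ k ℤ.+ + h ℤ.- 1ℤ ∣
      c≡ : + c ≡ k ℤ.+ + h ℤ.- 1ℤ
      c≡ = ℤ.0≤i⇒+∣i∣≡i (ℤ.≤-trans (+≤+ z≤n) κh≤)
      difference : ∀ k h → h ℤ.- (k ℤ.+ h ℤ.- 1ℤ) ≡ 1ℤ ℤ.- k
      difference k h = solve (k ∷ h ∷ [])
      κc≤h : part κ c ≤ h
      κc≤h = ≮⇒≥ (λ h<κc → <⇒≱ (symm h<κc) (ℤ.drop‿+≤+ (ℤ.≤-trans κh≤ (ℤ.≤-reflexive (sym c≡)))))
      h≤κc : ∀ h → (∀ {j} → j < h → 1ℤ ℤ.+ k ℤ.≤ β κ j) → + c ≡ k ℤ.+ + h ℤ.- 1ℤ → h ≤ part κ c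
      h≤κc zero    _      _  = z≤n
      h≤κc (suc j) before c≡ = symm (ℤ.drop‿+≤+ (arith (+ part κ j) (+ j) k (+ c) c≡ (before ≤-refl)))
        where
        arith : ∀ x j k c → c ≡ k ℤ.+ (1ℤ ℤ.+ j) ℤ.- 1ℤ → 1ℤ ℤ.+ k ℤ.≤ x ℤ.- j → 1ℤ ℤ.+ c ℤ.≤ x
        arith x j k c p q = lin (ℤ.≤-reflexive p ⊞ q) (solve (x ∷ j ∷ k ∷ c ∷ []))
      κc≡h : part κ c ≡ h
      κc≡h = ≤-antisym κc≤h (h≤κc h before c≡)

-- Hook lengths and 𝔭 in terms of beads

pos-∸ : ∀ {m n} → n ≤ m → + (m ∸ n) ≡ + m ℤ.- + n
pos-∸ {m} {n} n≤m = sym (trans (ℤ.m-n≡m⊖n m n) (ℤ.⊖-≥ n≤m))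

opaque
  unfolding β

  -- By symmetry column `c` has `part κ c` boxes, so the two counted sets are intervals: rows from
  -- `suc r` up to `part κ c`, and columns from `c` up to `part κ r`.
  hook-length : ∀ κ → Symmetric κ → ∀ r c → dg κ (r , c) → + suc (hl κ (r , c)) ≡ β κ r ℤ.+ β κ c
  hook-length κ symm r c c< = trans (cong₂ (λ x y → + suc (x + y)) column row)
    (trans (cong₂ (λ x y → 1ℤ ℤ.+ (x ℤ.+ y)) (pos-∸ (symm c<)) (pos-∸ (<⇒≤ c<)))
      (arith (+ part κ r) (+ part κ c) (+ r) (+ c)))
    where
    arith : ∀ x y r c → 1ℤ ℤ.+ (y ℤ.- (1ℤ ℤ.+ r) ℤ.+ (x ℤ.- c)) ≡ x ℤ.- r ℤ.+ (y ℤ.- c)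
    arith x y r c = solve (x ∷ y ∷ r ∷ c ∷ [])
    column : #boxes κ (λ (r′ , c′) → (r <? r′) ×-dec (c′ ≟ c)) ≡ part κ c ∸ suc r
    column = #boxes-interval κ _ (_, c) (cong proj₁) (suc r) (part κ c)
      (λ r<t t<κc → symm t<κc , r<t , refl)
      (λ { dg (r<r′ , refl) → _ , r<r′ , symm dg , refl })
    row : #boxes κ (λ (r′ , c′) → (r′ ≟ r) ×-dec (c ≤? c′)) ≡ part κ r ∸ c
    row = #boxes-interval κ _ (r ,_) (cong proj₂) c (part κ r)
      (λ c≤t t<κr → t<κr , refl , c≤t)
      (λ { dg (refl , c≤c′) → _ , c≤c′ , dg , refl })

-- `no-hook` can range over all pairs of rows: a sum of `1 + 2n` is positive and so already places
-- `(r , c)` in the diagram.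
record Core (n : ℕ) (κ : Partition) : Set where
  constructor core
  field
    symm    : Symmetric κ
    no-hook : ∀ r c → β κ r ℤ.+ β κ c ≢ 1ℤ ℤ.+ + (2 * n)

SymmetricCore⇒Core : ∀ {n κ} → SymmetricCore n κ → Core n κ
SymmetricCore⇒Core {n} {κ} sc = core symm no-hook
  where
  symm : Symmetric κ
  symm = Equivalence.to (SymmetricCore.symmetric sc _ _)
  no-hook : ∀ r c → β κ r ℤ.+ β κ c ≢ 1ℤ ℤ.+ + (2 * n)
  no-hook r c eq = SymmetricCore.core sc (r , c) c<
    (suc-injective (ℤ.+-injective (trans (hook-length κ symm r c c<) eq)))
    where
    c< : c < part κ r
    c< = 1≤sum⇒∈dg κ symm (subst (1ℤ ℤ.≤_) (sym eq) (+≤+ (s≤s z≤n)))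

Core⇒SymmetricCore : ∀ {n κ} → Core n κ → SymmetricCore n κ
Core⇒SymmetricCore {κ = κ} (core symm no-hook) = record
  { symmetric = λ _ _ → mk⇔ symm symm
  ; core      = λ { (r , c) c< eq → no-hook r c (trans (sym (hook-length κ symm r c c<)) (cong (λ x → + suc x) eq)) }
  }

-- For symmetric `κ` the height counts the columns in which row `b` has a hook of length at least
-- `2n`. It is used only through `height-cut`.
abstract
  height : ℕ → Partition → ℕ → ℕ
  height n κ b = proj₁ (cut-exists κ (1ℤ ℤ.+ + (2 * n) ℤ.- β κ b))

  height-cut : ∀ n κ b → Cut κ (1ℤ ℤ.+ + (2 * n) ℤ.- β κ b) (height n κ b)
  height-cut n κ b = proj₂ (cut-exists κ (1ℤ ℤ.+ + (2 * n) ℤ.- β κ b))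

-- The summand 1 of `𝔭` sits inside the difference, so that rows with `part κ b ≤ b` get 0, as do
-- positions beyond the end of the list `𝔭 n κ`.
𝔭-part : ℕ → Partition → ℕ → ℕ
𝔭-part n κ b = suc (part κ b) ∸ (suc b ⊔ height n κ b)

-- The box `(b , part κ b)` lies outside the diagram, so its bead sum is at most 0 and column
-- `part κ b` is not counted.
height≤part : ∀ n κ → Symmetric κ → ∀ b → height n κ b ≤ part κ b
height≤part n κ symm b = cut-≥ (height-cut n κ b)
  (arith (β κ b) (β κ (part κ b)) (+ (2 * n)) (∉dg⇒sum≤0 κ symm {b} (<-irrefl refl)) (+≤+ z≤n))
  where
  arith : ∀ y x m → y ℤ.+ x ℤ.≤ 0ℤ → 0ℤ ℤ.≤ m → 1ℤ ℤ.+ x ℤ.≤ 1ℤ ℤ.+ m ℤ.- y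
  arith y x m p q = lin (p ⊞ q) (solve (y ∷ x ∷ m ∷ []))

nth-applyUpTo : ∀ (f : ℕ → ℕ) {d b} → b < d → nth (applyUpTo f d) b ≡ f b
nth-applyUpTo f {suc d} {zero}  _         = refl
nth-applyUpTo f {suc d} {suc b} (s≤s b<d) = nth-applyUpTo (f ∘ suc) b<d

nth-map-upTo : ∀ (f : ℕ → ℕ) {d b} → b < d → nth (map f (upTo d)) b ≡ f b
nth-map-upTo f {d} b<d = trans (cong (λ xs → nth xs _) (map-upTo f d)) (nth-applyUpTo f b<d)

opaque
  unfolding β

  b<part⇒1≤β : ∀ κ {b} → b < part κ b → 1ℤ ℤ.≤ β κ b
  b<part⇒1≤β κ {b} p = arith (+ part κ b) (+ b) (+≤+ p)
    where
    arith : ∀ x b → 1ℤ ℤ.+ b ℤ.≤ x → 1ℤ ℤ.≤ x ℤ.- b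
    arith x b p = lin p (solve (x ∷ b ∷ []))

opaque
  unfolding β

  1≤β⇒b<part : ∀ κ {b} → 1ℤ ℤ.≤ β κ b → b < part κ b
  1≤β⇒b<part κ {b} p = ℤ.drop‿+≤+ (arith (+ part κ b) (+ b) p)
    where
    arith : ∀ x b → 1ℤ ℤ.≤ x ℤ.- b → 1ℤ ℤ.+ b ℤ.≤ x
    arith x b p = lin p (solve (x ∷ b ∷ []))

#diagonal : ∀ κ {d} → Cut κ 1ℤ d → #boxes κ (λ (i , j) → i ≟ j) ≡ d
#diagonal κ {d} c@(cut before _) = #boxes-interval κ _ (λ t → t , t) (cong proj₁) 0 d
  (λ _ t<d → 1≤β⇒b<part κ (before t<d) , refl)
  (λ { {i , _} dg refl → i , z≤n , cut-< c (b<part⇒1≤β κ dg) , refl })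

module _ (n : ℕ) (κ : Partition) (symm : Symmetric κ) where

  ⊔-height≤part : ∀ {b} → b < part κ b → suc b ⊔ height n κ b ≤ part κ b
  ⊔-height≤part b< = ⊔-lub b< (height≤part n κ symm _)

  -- Hooks in row `b` get shorter to the right, and those below `2n` start at column `height n κ b`;
  -- the diagonal condition contributes the bound `suc b`.
  #short-hooks : ∀ b → #boxes κ (λ (i , j) → (i ≟ b) ×-dec ((b <? j) ×-dec (hl κ (b , j) <? 2 * n)))
                       ≡ part κ b ∸ (suc b ⊔ height n κ b)
  #short-hooks b = #boxes-interval κ _ (b ,_) (cong proj₂) (suc b ⊔ height n κ b) (part κ b) inside only
    where
    inside : ∀ {t} → suc b ⊔ height n κ b ≤ t → t < part κ b → dg κ (b , t) × b ≡ b × b < t × hl κ (b , t) < 2 * n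
    inside {t} max≤t t< = t< , refl , m⊔n≤o⇒m≤o (suc b) (height n κ b) max≤t , ℤ.drop‿+≤+
      (arith (β κ b) (β κ t) (β κ (height n κ b)) (+ (2 * n)) _ (hook-length κ symm b t t<)
        (β-mono κ {height n κ b} (m⊔n≤o⇒n≤o (suc b) (height n κ b) max≤t)) (Cut.at (height-cut n κ b)))
      where
      arith : ∀ y x z m h → h ≡ y ℤ.+ x → x ℤ.≤ z → 1ℤ ℤ.+ z ℤ.≤ 1ℤ ℤ.+ m ℤ.- y → h ℤ.≤ m
      arith y x z m h p q r = lin (ℤ.≤-reflexive p ⊞ q ⊞ r) (solve (y ∷ x ∷ z ∷ m ∷ h ∷ []))
    only : ∀ {bx} → dg κ bx → proj₁ bx ≡ b × b < proj₂ bx × hl κ (b , proj₂ bx) < 2 * n →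
           ∃[ t ] suc b ⊔ height n κ b ≤ t × t < part κ b × bx ≡ (b , t)
    only {_ , t} t< (refl , b<t , short) = t , ⊔-lub b<t (cut-≥ (height-cut n κ b)
      (arith (β κ b) (β κ t) (+ (2 * n)) _ (hook-length κ symm b t t<) (+≤+ short))) , t< , refl
      where
      arith : ∀ y x m h → h ≡ y ℤ.+ x → h ℤ.≤ m → 1ℤ ℤ.+ x ℤ.≤ 1ℤ ℤ.+ m ℤ.- y
      arith y x m h p q = lin (ℤ.≤-reflexive (sym p) ⊞ q) (solve (y ∷ x ∷ m ∷ h ∷ []))

  nth-𝔭 : ∀ b → nth (𝔭 n κ) b ≡ 𝔭-part n κ b
  nth-𝔭 b = split (cut-exists κ 1ℤ)
    where
    split : ∃[ d ] Cut κ 1ℤ d → nth (𝔭 n κ) b ≡ 𝔭-part n κ b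
    split (d , c) = [ inside , outside ]′ (<-≤-connex b d)
      where
      length-𝔭 : length (𝔭 n κ) ≡ d
      length-𝔭 = trans (length-map _ (upTo (#boxes κ (λ (i , j) → i ≟ j)))) (trans (length-upTo _) (#diagonal κ c))
      inside : b < d → nth (𝔭 n κ) b ≡ 𝔭-part n κ b
      inside b<d = trans (nth-map-upTo _ (subst (b <_) (sym (#diagonal κ c)) b<d))
        (trans (cong suc (#short-hooks b)) (sym (+-∸-assoc 1 (⊔-height≤part {b} (1≤β⇒b<part κ {b} (Cut.before c b<d))))))
      -- Past the diagonal both sides are default zeros: `nth` has run off the list, and
      -- `part κ b ≤ b` truncates the difference.
      outside : d ≤ b → nth (𝔭 n κ) b ≡ 𝔭-part n κ b
      outside d≤b = trans (nth-zero (𝔭 n κ) (≤-trans (≤-reflexive length-𝔭) d≤b))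
        (sym (m≤n⇒m∸n≡0 (≤-trans (s≤s (≮⇒≥ (≤⇒≯ d≤b ∘ cut-< {j = b} c ∘ b<part⇒1≤β κ {b}))) (m≤m⊔n (suc b) (height n κ b)))))

-- The image of 𝔭 consists of bounded partitions

+2n : ∀ n → + (2 * n) ≡ + n ℤ.+ + n
+2n n = cong (λ x → + (n + x)) (+-identityʳ n)

half-≤ : ∀ {x y} → x ℤ.+ x ℤ.≤ 1ℤ ℤ.+ y ℤ.+ y → x ℤ.≤ y
half-≤ {x} {y} p with x ℤ.≤? y
... | yes q = q
... | no ¬q = ⊥-elim (1≰0 (lin (p ⊞ ≰⇒1+≤ ¬q ⊞ ≰⇒1+≤ ¬q) (solve (x ∷ y ∷ []))))

opaque
  unfolding β

  -- The first `r` rows have at least `k + r` boxes each and row `r` has at most `k + r`;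
  -- transposing this Durfee rectangle gives the rows counted by the second cut.
  durfee : ∀ κ → Symmetric κ → ∀ k r → Cut κ (1ℤ ℤ.+ + k) r → Cut κ (1ℤ ℤ.- + k) (k + r)
  durfee κ symm k r (cut before at) = cut
    (λ {j} j< → before-arith (+ part κ j) (+ j) (+ k) (+ r) (+≤+ (r≤part r before j<)) (+≤+ j<))
    (at-arith (+ part κ (k + r)) (+ k) (+ r) (+≤+ column))
    where
    before-arith : ∀ x j k r → r ℤ.≤ x → 1ℤ ℤ.+ j ℤ.≤ k ℤ.+ r → 1ℤ ℤ.- k ℤ.≤ x ℤ.- j
    before-arith x j k r p q = lin (p ⊞ q) (solve (x ∷ j ∷ k ∷ r ∷ []))
    at-arith : ∀ x k r → x ℤ.≤ r → 1ℤ ℤ.+ (x ℤ.- (k ℤ.+ r)) ℤ.≤ 1ℤ ℤ.- k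
    at-arith x k r p = lin p (solve (x ∷ k ∷ r ∷ []))
    column : part κ (k + r) ≤ r
    column = ≮⇒≥ λ r< → <⇒≱ (symm r<) (ℤ.drop‿+≤+ (arith (+ part κ r) (+ k) (+ r) at))
      where
      arith : ∀ x k r → 1ℤ ℤ.+ (x ℤ.- r) ℤ.≤ 1ℤ ℤ.+ k → x ℤ.≤ k ℤ.+ r
      arith x k r p = lin p (solve (x ∷ k ∷ r ∷ []))
    r≤part : ∀ r → (∀ {i} → i < r → 1ℤ ℤ.+ + k ℤ.≤ β κ i) → ∀ {j} → j < k + r → r ≤ part κ j
    r≤part zero    _      _      = z≤n
    r≤part (suc r) before {j} j< = symm (ℤ.drop‿+≤+ (arith (+ part κ r) (+ k) (+ r) (+ j) (before ≤-refl) (+≤+ j<)))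
      where
      arith : ∀ x k r j → 1ℤ ℤ.+ k ℤ.≤ x ℤ.- r → 1ℤ ℤ.+ j ℤ.≤ k ℤ.+ (1ℤ ℤ.+ r) → 1ℤ ℤ.+ j ℤ.≤ x
      arith x k r j p q = lin (p ⊞ q) (solve (x ∷ k ∷ r ∷ j ∷ []))

module _ {n : ℕ} {κ : Partition} (κ-core : Core n κ) where
  open Core κ-core

  private
    M : ℤ
    M = + (2 * n)

  -- Otherwise `1 - (β κ r - 2n)` would be a bead, and its sum with `β κ r` would be the forbidden
  -- `1 + 2n`.
  bead-down : ∀ r → ∃[ r′ ] β κ r′ ≡ β κ r ℤ.- M
  bead-down r with bead-or-gap κ symm (β κ r ℤ.- M)
  ... | inj₁ bead     = bead
  ... | inj₂ (c , eq) = ⊥-elim (no-hook r c (trans (cong (ℤ._+_ (β κ r)) eq) (arith (β κ r) M)))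
    where
    arith : ∀ y m → y ℤ.+ (1ℤ ℤ.- (y ℤ.- m)) ≡ 1ℤ ℤ.+ m
    arith y m = solve (y ∷ m ∷ [])

  beads-down : ∀ r t → ∃[ r′ ] β κ r′ ≡ β κ r ℤ.- + t ℤ.* M
  beads-down r zero = r , arith (β κ r) (M)
    where
    arith : ∀ y m → y ≡ y ℤ.- 0ℤ ℤ.* m
    arith y m = solve (y ∷ m ∷ [])
  beads-down r (suc t) with beads-down r t
  ... | r′ , eq with bead-down r′
  ...   | r″ , eq′ = r″ , arith (β κ r) (β κ r′) (β κ r″) (+ t) (M) eq eq′
    where
    arith : ∀ y y′ y″ t m → y′ ≡ y ℤ.- t ℤ.* m → y″ ≡ y′ ℤ.- m → y″ ≡ y ℤ.- (1ℤ ℤ.+ t) ℤ.* m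
    arith y y′ y″ t m refl refl = solve (y ∷ t ∷ m ∷ [])

  -- Between the cuts at 1 + 2n − y and 1 + 2n − z lie at most as many beads
  -- as between those at 1 − y and 1 − z, because beads can be moved down by 2n.
  cut-shift : ∀ {y z Ky Kz Hy Hz} → z ℤ.≤ y →
    Cut κ (1ℤ ℤ.- y) Ky → Cut κ (1ℤ ℤ.- z) Kz → Cut κ (1ℤ ℤ.+ M ℤ.- y) Hy → Cut κ (1ℤ ℤ.+ M ℤ.- z) Hz →
    Hy + Kz ≤ Hz + Ky
  cut-shift {y} {z} {Ky} {Kz} {Hy} {Hz} z≤y cKy cKz cHy cHz with Hy ≤? Hz
  ... | yes Hy≤Hz = +-mono-≤ Hy≤Hz (cut-≥ cKz (arith (β κ Ky) y z (Cut.at cKy) z≤y))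
    where
    arith : ∀ x y z → 1ℤ ℤ.+ x ℤ.≤ 1ℤ ℤ.- y → z ℤ.≤ y → 1ℤ ℤ.+ x ℤ.≤ 1ℤ ℤ.- z
    arith x y z p q = lin (p ⊞ q) (solve (x ∷ y ∷ z ∷ []))
  ... | no  Hy≰Hz = subst (λ h → h + Kz ≤ Hz + Ky) Hy≡ (≤-trans (≤-reflexive rearrange) (+-monoʳ-≤ Hz d+Kz<Ky))
    where
    d : ℕ
    d = Hy ∸ suc Hz
    Hy≡ : suc (d + Hz) ≡ Hy
    Hy≡ = trans (sym (+-suc d Hz)) (m∸n+n≡m (≰⇒> Hy≰Hz))
    rearrange : suc (d + Hz) + Kz ≡ Hz + suc (d + Kz)
    rearrange = trans (cong (λ x → suc (x + Kz)) (+-comm d Hz)) (trans (cong suc (+-assoc Hz d Kz)) (sym (+-suc Hz (d + Kz))))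
    -- The beads of rows `Hz` to `Hz + d`, lowered by `2n`, are distinct beads below `1 - z`, so the
    -- last of them is found no earlier than in row `Kz + d`.
    moved : ∀ d → β κ (d + Hz) ℤ.- M ℤ.≤ β κ (d + Kz)
    moved zero with bead-down Hz
    ... | r , eq = subst (ℤ._≤ β κ Kz) eq (β-mono κ (cut-≥ cKz (arith (β κ r) (β κ Hz) z M eq (Cut.at cHz))))
      where
      arith : ∀ x h z m → x ≡ h ℤ.- m → 1ℤ ℤ.+ h ℤ.≤ 1ℤ ℤ.+ m ℤ.- z → 1ℤ ℤ.+ x ℤ.≤ 1ℤ ℤ.- z
      arith x h z m p q = lin (ℤ.≤-reflexive p ⊞ q) (solve (x ∷ h ∷ z ∷ m ∷ []))
    moved (suc d) with bead-down (suc d + Hz)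
    ... | r , eq = subst (ℤ._≤ β κ (suc d + Kz)) eq (β-mono κ (β-reflects-< κ
          (arith (β κ r) (β κ (suc d + Hz)) (β κ (d + Hz)) (β κ (d + Kz)) M eq (β-anti κ {d + Hz} ≤-refl) (moved d))))
      where
      arith : ∀ x h h′ k m → x ≡ h ℤ.- m → 1ℤ ℤ.+ h ℤ.≤ h′ → h′ ℤ.- m ℤ.≤ k → 1ℤ ℤ.+ x ℤ.≤ k
      arith x h h′ k m p q r = lin (ℤ.≤-reflexive p ⊞ q ⊞ r) (solve (x ∷ h ∷ h′ ∷ k ∷ m ∷ []))
    d+Kz<Ky : d + Kz < Ky
    d+Kz<Ky = cut-< cKy (arith (β κ (d + Hz)) (β κ (d + Kz)) y M (moved d) (Cut.before cHy (≤-reflexive Hy≡)))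
      where
      arith : ∀ h k y m → h ℤ.- m ℤ.≤ k → 1ℤ ℤ.+ m ℤ.- y ℤ.≤ h → 1ℤ ℤ.- y ℤ.≤ k
      arith h k y m p q = lin (p ⊞ q) (solve (h ∷ k ∷ y ∷ m ∷ []))

  -- Column `j` meets row `b` exactly when `β κ b + β κ j` is positive, so the length of the row is
  -- itself a number of beads.
  part-cut : ∀ b → Cut κ (1ℤ ℤ.- β κ b) (part κ b)
  part-cut b = cut (λ {j} j< → arith₁ (β κ b) (β κ j) (∈dg⇒2≤sum κ symm {b} j<))
    (arith₂ (β κ b) (β κ (part κ b)) (∉dg⇒sum≤0 κ symm {b} (<-irrefl refl)))
    where
    arith₁ : ∀ y x → + 2 ℤ.≤ y ℤ.+ x → 1ℤ ℤ.- y ℤ.≤ x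
    arith₁ y x p = lin (p ⊞ (+≤+ {1} {2} (s≤s z≤n))) (solve (y ∷ x ∷ []))
    arith₂ : ∀ y x → y ℤ.+ x ℤ.≤ 0ℤ → 1ℤ ℤ.+ x ℤ.≤ 1ℤ ℤ.- y
    arith₂ y x p = lin p (solve (y ∷ x ∷ []))

  private
    h : ℕ → ℕ
    h = height n κ

    p : ℕ → ℕ
    p = 𝔭-part n κ

  𝔭-part-large-≡ : ∀ {b} → b < h b → p b ≡ suc (part κ b) ∸ h b
  𝔭-part-large-≡ {b} b<h = cong (suc (part κ b) ∸_) (m≤n⇒m⊔n≡n b<h)

  -- The hypothesis forces `n ≤ β κ b`, so `cut-shift` can compare `β κ b` with the content `n`,
  -- which need not be a bead. As `1 + 2n - n = 1 + n`, the upper cut for `n` is `r`, and `durfee`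
  -- gives `n + r` as the lower one; what remains is `n + h b ≤ part κ b`.
  𝔭-part-large : ∀ {b} → b < h b → n < p b
  𝔭-part-large {b} b<h with cut-exists κ (1ℤ ℤ.+ + n)
  ... | r , c = ≤-trans (m+n≤o⇒m≤o∸n (suc n) (s≤s n+h≤part)) (≤-reflexive (sym (𝔭-part-large-≡ b<h)))
    where
    n≤β : + n ℤ.≤ β κ b
    n≤β = half-≤ (arith (β κ b) M (+ n) (+2n n) (Cut.before (height-cut n κ b) b<h))
      where
      arith : ∀ y m n → m ≡ n ℤ.+ n → 1ℤ ℤ.+ m ℤ.- y ℤ.≤ y → n ℤ.+ n ℤ.≤ 1ℤ ℤ.+ y ℤ.+ y
      arith y m n p q = lin (ℤ.≤-reflexive (sym p) ⊞ q ⊞ +≤+ {0} {2} z≤n) (solve (y ∷ m ∷ n ∷ []))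
    cut-n : Cut κ (1ℤ ℤ.+ M ℤ.- + n) r
    cut-n = subst (λ k → Cut κ k r) (arith M (+ n) (+2n n)) c
      where
      arith : ∀ m n → m ≡ n ℤ.+ n → 1ℤ ℤ.+ n ≡ 1ℤ ℤ.+ m ℤ.- n
      arith m n p = lin≡ (sym p) (solve (m ∷ n ∷ []))
    n+h≤part : n + h b ≤ part κ b
    n+h≤part = +-cancelˡ-≤ r _ _ (≤-trans (≤-reflexive rearrange)
      (cut-shift n≤β (part-cut b) (durfee κ symm n r c) (height-cut n κ b) cut-n))
      where
      rearrange : r + (n + h b) ≡ h b + (n + r)
      rearrange = trans (sym (+-assoc r n (h b))) (trans (+-comm (r + n) (h b)) (cong (λ x → h b + x) (+-comm r n)))

  𝔭-part≤ : ∀ b → p b ≤ part κ b ∸ b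
  𝔭-part≤ b = ∸-monoʳ-≤ (suc (part κ b)) (m≤m⊔n (suc b) (h b))

  opaque
    unfolding β

    -- Row `h b` comes no later than `b`, so `β κ b` is at most its bead, which is below
    -- `1 + 2n - β κ b`; hence `β κ b ≤ n`.
    𝔭-part-small : ∀ {b} → h b ≤ b → p b ≡ part κ b ∸ b × p b ≤ n
    𝔭-part-small {b} h≤b = eq , ≤-trans (≤-reflexive eq) (m≤n+o⇒m∸n≤o (part κ b) b
      (ℤ.drop‿+≤+ (arith₂ (+ part κ b) (+ b) (+ n) (half-≤ (arith₁ (β κ b) (β κ (h b)) M (+ n) (+2n n) (Cut.at (height-cut n κ b)) (β-mono κ h≤b))))))
      where
      eq : p b ≡ part κ b ∸ b
      eq = cong (suc (part κ b) ∸_) (m≥n⇒m⊔n≡m (m≤n⇒m≤1+n h≤b))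
      arith₁ : ∀ y x m n → m ≡ n ℤ.+ n → 1ℤ ℤ.+ x ℤ.≤ 1ℤ ℤ.+ m ℤ.- y → y ℤ.≤ x → y ℤ.+ y ℤ.≤ 1ℤ ℤ.+ n ℤ.+ n
      arith₁ y x m n p q r = lin (ℤ.≤-reflexive p ⊞ q ⊞ r ⊞ +≤+ {0} {1} z≤n) (solve (y ∷ x ∷ m ∷ n ∷ []))
      arith₂ : ∀ x b n → x ℤ.- b ℤ.≤ n → x ℤ.≤ b ℤ.+ n
      arith₂ x b n p = lin p (solve (x ∷ b ∷ n ∷ []))

  -- If `b` is small, the distances to the diagonal compare directly; if only `suc b` is small, the
  -- value `n` separates the two; if both are large, `cut-shift` compares the neighbouring rows.
  𝔭-part-antitone : ∀ b → p (suc b) ≤ p b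
  𝔭-part-antitone b with h b ≤? b | h (suc b) ≤? suc b
  ... | yes small | _ = ≤-trans (𝔭-part≤ (suc b))
        (≤-trans (∸-mono (part-antitone κ b) (n≤1+n b)) (≤-reflexive (sym (proj₁ (𝔭-part-small small)))))
  ... | no  large | yes small′ = ≤-trans (proj₂ (𝔭-part-small small′)) (<⇒≤ (𝔭-part-large (≰⇒> large)))
  ... | no  large | no  large′ = subst₂ _≤_ (sym (𝔭-part-large-≡ (≰⇒> large′))) (sym (𝔭-part-large-≡ (≰⇒> large)))
        (m≤n+o⇒m∸n≤o _ (h (suc b)) (+-cancelˡ-≤ (h b) _ _ (begin
          h b + suc (part κ (suc b))                       ≡⟨ +-suc (h b) _ ⟩
          suc (h b + part κ (suc b))                       ≤⟨ s≤s shift ⟩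
          suc (h (suc b) + part κ b)                       ≡⟨ +-suc (h (suc b)) _ ⟨
          h (suc b) + suc (part κ b)                       ≡⟨ cong (λ x → h (suc b) + x) (m+[n∸m]≡n h≤) ⟨
          h (suc b) + (h b + (suc (part κ b) ∸ h b))       ≡⟨ +-assoc (h (suc b)) (h b) _ ⟨
          h (suc b) + h b + (suc (part κ b) ∸ h b)         ≡⟨ cong (λ x → x + (suc (part κ b) ∸ h b)) (+-comm (h (suc b)) (h b)) ⟩
          h b + h (suc b) + (suc (part κ b) ∸ h b)         ≡⟨ +-assoc (h b) (h (suc b)) _ ⟩
          h b + (h (suc b) + (suc (part κ b) ∸ h b))       ∎)))
    where
    open ≤-Reasoning
    h≤ : h b ≤ suc (part κ b)
    h≤ = m≤n⇒m≤1+n (height≤part n κ symm b)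
    shift : h b + part κ (suc b) ≤ h (suc b) + part κ b
    shift = cut-shift (β-mono κ (n≤1+n b)) (part-cut b) (part-cut (suc b)) (height-cut n κ b) (height-cut n κ (suc b))

  -- A value of at most `n` belongs to the small case, where it is a positive distance to the
  -- diagonal; the next row loses at least one because the diagonal advances.
  𝔭-part-strict : ∀ {b} → 0 < p b → p b ≤ n → p (suc b) < p b
  𝔭-part-strict {b} 0<p p≤n with h b ≤? b
  ... | no  large = ⊥-elim (<⇒≱ (𝔭-part-large (≰⇒> large)) p≤n)
  ... | yes small = ≤-trans (s≤s (𝔭-part≤ (suc b))) (≤-trans
        (≤-<-trans (∸-monoˡ-≤ (suc b) (part-antitone κ b)) (∸-monoʳ-< {part κ b} ≤-refl b<part))
        (≤-reflexive (sym (proj₁ (𝔭-part-small small)))))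
    where
    b<part : b < part κ b
    b<part = m∸n≢0⇒n<m λ z → case subst (0 <_) (trans (proj₁ (𝔭-part-small small)) z) 0<p of λ ()

  -- In the large case the columns from `h b` to the end of row `b` have distinct hook lengths
  -- between 1 and `2n - 1`, so there are fewer than `2n` of them; if there are none, the bound
  -- comes from `1 ≤ n`.
  𝔭-part≤2n : 1 ≤ n → ∀ b → p b ≤ 2 * n
  𝔭-part≤2n 1≤n b with h b ≤? b
  ... | yes small = ≤-trans (proj₂ (𝔭-part-small small)) (m≤m+n n _)
  ... | no  large = ≤-trans (≤-reflexive (𝔭-part-large-≡ (≰⇒> large))) (m≤n+o⇒m∸n≤o _ (h b) (bound (height≤part n κ symm b)))
    where
    bound : h b ≤ part κ b → part κ b < h b + 2 * n
    bound h≤ with m≤n⇒m<n∨m≡n h≤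
    ... | inj₂ eq = subst (_< h b + 2 * n) eq (m<m+n (h b) (≤-trans 1≤n (m≤m+n n _)))
    ... | inj₁ h< = subst₂ _≤_ (cong suc part≡) (+-comm (2 * n) (h b)) (+-monoˡ-≤ (h b) (ℤ.drop‿+≤+ d+2≤2n))
      where
      d : ℕ
      d = part κ b ∸ suc (h b)
      part≡ : suc (d + h b) ≡ part κ b
      part≡ = trans (sym (+-suc d (h b))) (m∸n+n≡m h<)
      d+2≤2n : + suc (suc d) ℤ.≤ M
      d+2≤2n = arith (β κ b) (β κ (d + h b)) (β κ (h b)) (+ d) M (∈dg⇒2≤sum κ symm {b} (≤-reflexive part≡))
        (β-drop κ (h b) d) (Cut.at (height-cut n κ b))
        where
        arith : ∀ y x k d m → + 2 ℤ.≤ y ℤ.+ x → x ℤ.+ d ℤ.≤ k → 1ℤ ℤ.+ k ℤ.≤ 1ℤ ℤ.+ m ℤ.- y → 1ℤ ℤ.+ (1ℤ ℤ.+ d) ℤ.≤ m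
        arith y x k d m p q r = lin (p ⊞ q ⊞ r) (solve (y ∷ x ∷ k ∷ d ∷ m ∷ []))

  𝔭-partition : Partition
  𝔭-partition = mkPartition (𝔭 n κ)
    (linked (𝔭 n κ) (λ b → subst₂ _≤_ (sym (nth-𝔭 n κ symm (suc b))) (sym (nth-𝔭 n κ symm b)) (𝔭-part-antitone b)))
    (All.map⁺ (All.universal (λ _ → s≤s z≤n) (upTo (#boxes κ (λ (i , j) → i ≟ j)))))
    where
    linked : ∀ xs → (∀ b → nth xs (suc b) ≤ nth xs b) → Linked _≥_ xs
    linked []           _ = Linked.[]
    linked (x ∷ [])     _ = Linked.[-]
    linked (x ∷ y ∷ xs) f = f 0 Linked.∷ linked (y ∷ xs) (f ∘ suc)

  𝔭-bounded : 1 ≤ n → BoundedPartition n 𝔭-partition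
  𝔭-bounded 1≤n = record
    { bounded = subst (_≤ 2 * n) (sym (part≡ 0)) (𝔭-part≤2n 1≤n 0)
    ; strict  = λ b b< ≤n → subst₂ _<_ (sym (part≡ (suc b))) (sym (part≡ b))
        (𝔭-part-strict (subst (0 <_) (part≡ b) (nth-positive (positive 𝔭-partition) (<-trans ≤-refl b<)))
          (subst (_≤ n) (part≡ b) ≤n))
    }
    where
    part≡ : ∀ b → part 𝔭-partition b ≡ p b
    part≡ = nth-𝔭 n κ symm
    nth-positive : ∀ {xs b} → All (0 <_) xs → b < length xs → 0 < nth xs b
    nth-positive {b = zero}  (0<x All.∷ _)  _         = 0<x
    nth-positive {b = suc b} (_ All.∷ 0<xs) (s≤s b<) = nth-positive 0<xs b<

-- Adding boxes in a set of rows of residue ±i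

-- Here `- i` stands for `2n - i`; the difference is absorbed in `t`.
Residue± : ℕ → ℤ → ℤ → Set
Residue± n i x = ∃[ t ] (x ≡ t ℤ.* + (2 * n) ℤ.+ i ⊎ x ≡ t ℤ.* + (2 * n) ℤ.- i)

double≢suc-double : ∀ w k → w ℤ.+ w ≢ 1ℤ ℤ.+ (k ℤ.+ k)
double≢suc-double w k eq = 1+≤⇒≰ 1+k≤w w≤k
  where
  w≤k : w ℤ.≤ k
  w≤k = half-≤ (lin (ℤ.≤-reflexive eq) (solve (w ∷ k ∷ [])))
  1+k≤w : 1ℤ ℤ.+ k ℤ.≤ w
  1+k≤w = half-≤ (lin (ℤ.≤-reflexive (sym eq)) (solve (w ∷ k ∷ [])))

module _ {n : ℕ} {i : ℤ} where

  private
    M : ℤ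
    M = + (2 * n)

  -- Modulo the even number `2n` the sum is `2i`, `0` or `-2i`.
  residue-sum-even : ∀ {x y} → Residue± n i x → Residue± n i y → ∀ k → x ℤ.+ y ≢ 1ℤ ℤ.+ (k ℤ.+ k)
  residue-sum-even {x} {y} (t , p) (u , q) k eq = let w , x+y≡ = half p q in
    double≢suc-double w k (trans (sym x+y≡) eq)
    where
    arith₁ : ∀ x y t u i m n → m ≡ n ℤ.+ n → x ≡ t ℤ.* m ℤ.+ i → y ≡ u ℤ.* m ℤ.+ i →
             ∃[ w ] x ℤ.+ y ≡ w ℤ.+ w
    arith₁ x y t u i m n refl refl refl = t ℤ.* n ℤ.+ u ℤ.* n ℤ.+ i , solve (t ∷ u ∷ i ∷ n ∷ [])
    arith₂ : ∀ x y t u i m n → m ≡ n ℤ.+ n → x ≡ t ℤ.* m ℤ.+ i → y ≡ u ℤ.* m ℤ.- i →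
             ∃[ w ] x ℤ.+ y ≡ w ℤ.+ w
    arith₂ x y t u i m n refl refl refl = t ℤ.* n ℤ.+ u ℤ.* n , solve (t ∷ u ∷ i ∷ n ∷ [])
    arith₃ : ∀ x y t u i m n → m ≡ n ℤ.+ n → x ≡ t ℤ.* m ℤ.- i → y ≡ u ℤ.* m ℤ.+ i →
             ∃[ w ] x ℤ.+ y ≡ w ℤ.+ w
    arith₃ x y t u i m n refl refl refl = t ℤ.* n ℤ.+ u ℤ.* n , solve (t ∷ u ∷ i ∷ n ∷ [])
    arith₄ : ∀ x y t u i m n → m ≡ n ℤ.+ n → x ≡ t ℤ.* m ℤ.- i → y ≡ u ℤ.* m ℤ.- i →
             ∃[ w ] x ℤ.+ y ≡ w ℤ.+ w
    arith₄ x y t u i m n refl refl refl = t ℤ.* n ℤ.+ u ℤ.* n ℤ.- i , solve (t ∷ u ∷ i ∷ n ∷ [])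
    half : x ≡ t ℤ.* M ℤ.+ i ⊎ x ≡ t ℤ.* M ℤ.- i → y ≡ u ℤ.* M ℤ.+ i ⊎ y ≡ u ℤ.* M ℤ.- i →
           ∃[ w ] x ℤ.+ y ≡ w ℤ.+ w
    half (inj₁ p) (inj₁ q) = arith₁ x y t u i M (+ n) (+2n n) p q
    half (inj₁ p) (inj₂ q) = arith₂ x y t u i M (+ n) (+2n n) p q
    half (inj₂ p) (inj₁ q) = arith₃ x y t u i M (+ n) (+2n n) p q
    half (inj₂ p) (inj₂ q) = arith₄ x y t u i M (+ n) (+2n n) p q

  -- The second alternative is not simplified to a sum, so that both say that `y` is congruent to
  -- some `e`, namely `x` or `- x`; this is the form that `congruent-below` takes.
  residue-congruent : ∀ {x y} → Residue± n i x → Residue± n i y →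
                      (∃[ t ] y ℤ.- x ≡ t ℤ.* M) ⊎ (∃[ t ] y ℤ.- ℤ.- x ≡ t ℤ.* M)
  residue-congruent {x} {y} (t , p) (u , q) = go p q
    where
    arith₁ : ∀ x y t u i m → x ≡ t ℤ.* m ℤ.+ i → y ≡ u ℤ.* m ℤ.+ i → ∃[ s ] y ℤ.- x ≡ s ℤ.* m
    arith₁ x y t u i m refl refl = (u ℤ.- t) , solve (t ∷ u ∷ i ∷ m ∷ [])
    arith₂ : ∀ x y t u i m → x ≡ t ℤ.* m ℤ.+ i → y ≡ u ℤ.* m ℤ.- i → ∃[ s ] y ℤ.- ℤ.- x ≡ s ℤ.* m
    arith₂ x y t u i m refl refl = (u ℤ.+ t) , solve (t ∷ u ∷ i ∷ m ∷ [])
    arith₃ : ∀ x y t u i m → x ≡ t ℤ.* m ℤ.- i → y ≡ u ℤ.* m ℤ.+ i → ∃[ s ] y ℤ.- ℤ.- x ≡ s ℤ.* m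
    arith₃ x y t u i m refl refl = (u ℤ.+ t) , solve (t ∷ u ∷ i ∷ m ∷ [])
    arith₄ : ∀ x y t u i m → x ≡ t ℤ.* m ℤ.- i → y ≡ u ℤ.* m ℤ.- i → ∃[ s ] y ℤ.- x ≡ s ℤ.* m
    arith₄ x y t u i m refl refl = (u ℤ.- t) , solve (t ∷ u ∷ i ∷ m ∷ [])
    go : x ≡ t ℤ.* M ℤ.+ i ⊎ x ≡ t ℤ.* M ℤ.- i → y ≡ u ℤ.* M ℤ.+ i ⊎ y ≡ u ℤ.* M ℤ.- i → _
    go (inj₁ p) (inj₁ q) = inj₁ (arith₁ x y t u i M p q)
    go (inj₁ p) (inj₂ q) = inj₂ (arith₂ x y t u i M p q)
    go (inj₂ p) (inj₁ q) = inj₂ (arith₃ x y t u i M p q)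
    go (inj₂ p) (inj₂ q) = inj₁ (arith₄ x y t u i M p q)

max-exists : ∀ {P : Pred ℕ 0ℓ} → Decidable P → ∀ N → (∀ c → P c → c ≤ N) → ∀ {c} → P c → ∃[ m ] IsMax P m
max-exists P? zero    bound {c} Pc with refl ← n≤0⇒n≡0 (bound c Pc) = 0 , Pc , bound
max-exists P? (suc N) bound Pc with P? (suc N)
... | yes Pm = suc N , Pm , bound
... | no ¬Pm = max-exists P? N (λ c Pc′ → ≤-pred (≤∧≢⇒< (bound c Pc′) λ { refl → ¬Pm Pc′ })) Pc

opaque
  unfolding β

  0≤β⇒≤part : ∀ κ {b} → 0ℤ ℤ.≤ β κ b → b ≤ part κ b
  0≤β⇒≤part κ 0≤ = ℤ.drop‿+≤+ (ℤ.0≤i-j⇒j≤i 0≤)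

  ≤part⇒0≤β : ∀ κ {b} → b ≤ part κ b → 0ℤ ℤ.≤ β κ b
  ≤part⇒0≤β κ b≤ = ℤ.i≤j⇒0≤j-i (+≤+ b≤)

-- Moving a set of beads up by one

Move : Partition → Partition → Pred ℕ 0ℓ → Set
Move κ κ′ A = ∀ r → (A r × part κ′ r ≡ suc (part κ r)) ⊎ (¬ A r × part κ′ r ≡ part κ r)

module Moves (κ κ′ : Partition) {A : Pred ℕ 0ℓ} (move : Move κ κ′ A) where

  in-move? : Decidable A
  in-move? r with move r
  ... | inj₁ (a , _) = yes a
  ... | inj₂ (a , _) = no a

  part-moved : ∀ {r} → A r → part κ′ r ≡ suc (part κ r)
  part-moved {r} a with move r
  ... | inj₁ (_ , eq) = eq
  ... | inj₂ (¬a , _) = ⊥-elim (¬a a)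

  part-fixed : ∀ {r} → ¬ A r → part κ′ r ≡ part κ r
  part-fixed {r} ¬a with move r
  ... | inj₁ (a , _)  = ⊥-elim (¬a a)
  ... | inj₂ (_ , eq) = eq

  opaque
    unfolding β

    β-moved : ∀ {r} → A r → β κ′ r ≡ 1ℤ ℤ.+ β κ r
    β-moved {r} a = trans (cong (λ x → + x ℤ.- + r) (part-moved a)) (ℤ.+-assoc 1ℤ (+ part κ r) (ℤ.- (+ r)))

    β-fixed : ∀ {r} → ¬ A r → β κ′ r ≡ β κ r
    β-fixed {r} ¬a = cong (λ x → + x ℤ.- + r) (part-fixed ¬a)

  sum-moved-moved : ∀ {r c} → A r → A c → β κ′ r ℤ.+ β κ′ c ≡ + 2 ℤ.+ (β κ r ℤ.+ β κ c)
  sum-moved-moved {r} {c} a a′ = trans (cong₂ ℤ._+_ (β-moved a) (β-moved a′)) (arith (β κ r) (β κ c))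
    where
    arith : ∀ x y → 1ℤ ℤ.+ x ℤ.+ (1ℤ ℤ.+ y) ≡ + 2 ℤ.+ (x ℤ.+ y)
    arith x y = solve (x ∷ y ∷ [])

  sum-moved-fixed : ∀ {r c} → A r → ¬ A c → β κ′ r ℤ.+ β κ′ c ≡ 1ℤ ℤ.+ (β κ r ℤ.+ β κ c)
  sum-moved-fixed {r} {c} a ¬a = trans (cong₂ ℤ._+_ (β-moved a) (β-fixed ¬a)) (ℤ.+-assoc 1ℤ (β κ r) (β κ c))

  sum-fixed-fixed : ∀ {r c} → ¬ A r → ¬ A c → β κ′ r ℤ.+ β κ′ c ≡ β κ r ℤ.+ β κ c
  sum-fixed-fixed ¬a ¬a′ = cong₂ ℤ._+_ (β-fixed ¬a) (β-fixed ¬a′)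

-- A step always goes upwards: for a removal `κ` is the result of the action and `κ′` the core it
-- started from, so one analysis serves both cases.
record Step (n : ℕ) (i : ℤ) (κ κ′ : Partition) (A : Pred ℕ 0ℓ) : Set where
  field
    core-before : Core n κ
    core-after  : Core n κ′
    move        : Move κ κ′ A
    residue     : ∀ {r} → A r → Residue± n i (β κ r)

module _ {n : ℕ} {i : ℤ} {κ κ′ : Partition} {A : Pred ℕ 0ℓ} (step : Step n i κ κ′ A) where
  open Step step
  open Core core-before
  open Moves κ κ′ move
  open Core core-after using () renaming (symm to symm′; no-hook to no-hook′)

  private
    M : ℤ
    M = + (2 * n)

  sum-even : ∀ {r c} → A r → A c → ∀ k → β κ r ℤ.+ β κ c ≢ 1ℤ ℤ.+ (k ℤ.+ k)
  sum-even a a′ = residue-sum-even {n} {i} (residue a) (residue a′)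

  -- The bead k + 1 would have to make room for the bead moving from k.
  next-free : ∀ {r c} → A r → β κ c ≢ 1ℤ ℤ.+ β κ r
  next-free {r} {c} a eq with in-move? c
  ... | yes a′ = sum-even a a′ (β κ r) (arith (β κ r) (β κ c) eq)
    where
    arith : ∀ x y → y ≡ 1ℤ ℤ.+ x → x ℤ.+ y ≡ 1ℤ ℤ.+ (x ℤ.+ x)
    arith x y refl = solve (x ∷ [])
  ... | no ¬a′ = ¬a′ (subst A (β-injective κ′ {r} {c} (trans (β-moved a) (sym (trans (β-fixed ¬a′) eq)))) a)

  -- If `- β κ r` is no bead, then `1 + β κ r` is one and blocks the move; if it is a bead that
  -- stays, the two beads sum to 1 in `κ′`, which symmetry excludes.
  opposite : ∀ {r} → A r → ∃[ c ] A c × β κ c ≡ ℤ.- β κ r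
  opposite {r} a with bead-or-gap κ symm (ℤ.- β κ r)
  ... | inj₂ (c , eq) = ⊥-elim (next-free {r} {c} a (trans eq (cong (ℤ._+_ 1ℤ) (ℤ.neg-involutive (β κ r)))))
  ... | inj₁ (c , eq) with in-move? c
  ...   | yes a′ = c , a′ , eq
  ...   | no ¬a′ = ⊥-elim (sum≢1 κ′ symm′ r c (trans (sum-moved-fixed a ¬a′)
                     (trans (cong (λ x → 1ℤ ℤ.+ (β κ r ℤ.+ x)) eq) (cong (ℤ._+_ 1ℤ) (ℤ.+-inverseʳ (β κ r))))))

  -- A bead `2n - β κ r` that stayed would sum to `1 + 2n` with the moved one.
  mirror : ∀ {r c} → A r → β κ c ≡ M ℤ.- β κ r → A c
  mirror {r} {c} a eq with in-move? c
  ... | yes a′ = a′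
  ... | no ¬a′ = ⊥-elim (no-hook′ r c (trans (sum-moved-fixed a ¬a′) (cong (ℤ._+_ 1ℤ) (arith (β κ r) (β κ c) M eq))))
    where
    arith : ∀ x y m → y ≡ m ℤ.- x → x ℤ.+ y ≡ m
    arith x y m refl = solve (x ∷ m ∷ [])

  -- A bead moving up by one enters the count only from content `k - 1`.
  cut-step : ∀ {k h} → (∀ {j} → A j → 1ℤ ℤ.+ β κ j ≢ k) → Cut κ k h → Cut κ′ k h
  cut-step {k} {h} ≢k (cut before at) = cut (λ {j} j<h → ℤ.≤-trans (before j<h) (grow j)) at′
    where
    grow : ∀ j → β κ j ℤ.≤ β κ′ j
    grow j with in-move? j
    ... | yes a = ℤ.≤-trans (ℤ.i≤suc[i] _) (ℤ.≤-reflexive (sym (β-moved a)))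
    ... | no ¬a = ℤ.≤-reflexive (sym (β-fixed ¬a))
    at′ : 1ℤ ℤ.+ β κ′ h ℤ.≤ k
    at′ with in-move? h
    ... | yes a = subst (λ x → 1ℤ ℤ.+ x ℤ.≤ k) (sym (β-moved a)) (≤∧≢⇒1+≤ at (≢k a))
    ... | no ¬a = subst (λ x → 1ℤ ℤ.+ x ℤ.≤ k) (sym (β-fixed ¬a)) at

  -- A bead crossing the threshold would reach the forbidden sum `1 + 2n` with row `b` in `κ′`.
  height-fixed : ∀ {b} → ¬ A b → height n κ′ b ≡ height n κ b
  height-fixed {b} ¬a = cut-unique
    (subst (λ x → Cut κ′ (1ℤ ℤ.+ M ℤ.- x) (height n κ′ b)) (β-fixed ¬a) (height-cut n κ′ b))
    (cut-step (λ {j} a eq → no-hook′ j b (trans (sum-moved-fixed a ¬a) (arith (β κ j) (β κ b) M eq))) (height-cut n κ b))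
    where
    arith : ∀ x y m → 1ℤ ℤ.+ x ≡ 1ℤ ℤ.+ m ℤ.- y → 1ℤ ℤ.+ (x ℤ.+ y) ≡ 1ℤ ℤ.+ m
    arith x y m p = lin≡ p (solve (x ∷ y ∷ m ∷ []))

  -- The move of row `b` lowers its threshold to `2n - β κ b`; a bead crossing this one would have
  -- the odd sum `2n - 1` with `β κ b`.
  height-moved : ∀ {b h} → A b → Cut κ (M ℤ.- β κ b) h → height n κ′ b ≡ h
  height-moved {b} a c = cut-unique
    (subst (λ k → Cut κ′ k (height n κ′ b)) (arith₁ (β κ b) (β κ′ b) M (β-moved a)) (height-cut n κ′ b))
    (cut-step (λ {j} a′ eq → sum-even a′ a (+ n ℤ.- 1ℤ) (arith₂ (β κ j) (β κ b) M (+ n) (+2n n) eq)) c)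
    where
    arith₁ : ∀ y y′ m → y′ ≡ 1ℤ ℤ.+ y → 1ℤ ℤ.+ m ℤ.- y′ ≡ m ℤ.- y
    arith₁ y y′ m refl = solve (y ∷ m ∷ [])
    arith₂ : ∀ x y m n → m ≡ n ℤ.+ n → 1ℤ ℤ.+ x ≡ m ℤ.- y → x ℤ.+ y ≡ 1ℤ ℤ.+ (n ℤ.- 1ℤ ℤ.+ (n ℤ.- 1ℤ))
    arith₂ x y m n refl p = lin≡ p (solve (x ∷ y ∷ n ∷ []))

  height-blocked : ∀ {b} → A b → β κ (height n κ b) ≡ M ℤ.- β κ b → height n κ′ b ≡ suc (height n κ b)
  height-blocked {b} a eq = height-moved a (cut
    (λ { (s≤s j≤h) → ℤ.≤-trans (ℤ.≤-reflexive (sym eq)) (β-mono κ j≤h) })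
    (ℤ.≤-trans (β-anti κ {height n κ b} ≤-refl) (ℤ.≤-reflexive eq)))

  height-free : ∀ {b} → A b → β κ (height n κ b) ≢ M ℤ.- β κ b → height n κ′ b ≡ height n κ b
  height-free {b} a neq = height-moved a (cut
    (λ {j} j<h → ℤ.≤-trans (arith₁ (β κ b) M) (before j<h))
    (≤∧≢⇒1+≤ (arith₂ (β κ b) (β κ (height n κ b)) M at) neq))
    where
    open Cut (height-cut n κ b)
    arith₁ : ∀ y m → m ℤ.- y ℤ.≤ 1ℤ ℤ.+ m ℤ.- y
    arith₁ y m = lin (+≤+ {0} {1} z≤n) (solve (y ∷ m ∷ []))
    arith₂ : ∀ y x m → 1ℤ ℤ.+ x ℤ.≤ 1ℤ ℤ.+ m ℤ.- y → x ℤ.≤ m ℤ.- y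
    arith₂ y x m p = lin p (solve (y ∷ x ∷ m ∷ []))

  -- `β κ c` is the content of the box by which row `c` changes, so these are the rows of
  -- `AddableRow`, or of `RemovableRow` for a removal.
  Upper : Pred ℕ 0ℓ
  Upper c = A c × 0ℤ ℤ.≤ β κ c

  upper-exists : ∀ {r} → A r → ∃[ c ] Upper c
  upper-exists {r} a with 0ℤ ℤ.≤? β κ r
  ... | yes 0≤ = r , a , 0≤
  ... | no  0≰ with c , a′ , eq ← opposite a = c , a′ , subst (0ℤ ℤ.≤_) (sym eq) (ℤ.neg-mono-≤ (ℤ.<⇒≤ (ℤ.≰⇒> 0≰)))

  upper-max : ∀ {r} → A r → ∃[ a ] IsMax Upper a
  upper-max a with c , u ← upper-exists a = max-exists (λ c → in-move? c ×-dec (0ℤ ℤ.≤? β κ c)) (part κ 0) bound u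
    where
    bound : ∀ c → Upper c → c ≤ part κ 0
    bound c (_ , 0≤) = ≤-trans (0≤β⇒≤part κ 0≤) (part-mono κ z≤n)

  -- Effect of a move on the image under `𝔭`

  module _ (1≤n : 1 ≤ n) {a : ℕ} (a-max : IsMax Upper a) where

    private
      y : ℤ
      y = β κ a
      Aa : A a
      Aa = proj₁ (proj₁ a-max)
      maximal : ∀ {c} → A c → 0ℤ ℤ.≤ β κ c → y ℤ.≤ β κ c
      maximal a′ 0≤ = β-mono κ (proj₂ a-max _ (a′ , 0≤))
      1≤M : 1ℤ ℤ.≤ M
      1≤M = +≤+ (≤-trans 1≤n (m≤m+n n _))

    -- Otherwise 2n − y or its opposite would be a smaller content.
    max-not-blocked : β κ (height n κ a) ≡ M ℤ.- y → height n κ a ≤ a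
    max-not-blocked eq = ≮⇒≥ λ a<h → smaller (β-anti κ a<h) (mirror Aa eq)
      where
      smaller : 1ℤ ℤ.+ β κ (height n κ a) ℤ.≤ y → A (height n κ a) → ⊥
      smaller p a′ with 0ℤ ℤ.≤? β κ (height n κ a)
      ... | yes 0≤ = 1+≤⇒≰ p (maximal a′ 0≤)
      ... | no  0≰ with c , a″ , eq′ ← opposite a′ =
            1≰0 (arith y (β κ (height n κ a)) (β κ c) M eq eq′ 1≤M
              (maximal a″ (subst (0ℤ ℤ.≤_) (sym eq′) (ℤ.neg-mono-≤ (ℤ.<⇒≤ (ℤ.≰⇒> 0≰))))))
        where
        arith : ∀ y x x′ m → x ≡ m ℤ.- y → x′ ≡ ℤ.- x → 1ℤ ℤ.≤ m → y ℤ.≤ x′ → 1ℤ ℤ.≤ 0ℤ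
        arith y x x′ m refl refl p q = lin (p ⊞ q) (solve (y ∷ m ∷ []))

    -- A gap at 2n − β b would force, by moving beads down by multiples of 2n,
    -- a bead right after the one that moves in row e.
    congruent-below : ∀ {b e} → A e → β κ e ℤ.≤ y → ℤ.- β κ e ℤ.≤ y → 1ℤ ℤ.+ y ℤ.≤ β κ b →
      ∃[ t ] β κ b ℤ.- β κ e ≡ t ℤ.* M → β κ (height n κ b) ≡ M ℤ.- β κ b × b < height n κ b
    congruent-below {b} {e} a′ e≤y -e≤y y<b (t , eq) = go t eq
      where
      absurd : ∀ t → t ℤ.≤ 0ℤ → β κ b ℤ.- β κ e ≡ t ℤ.* M → ⊥
      absurd t t≤0 eq = 1≰0 (arith (β κ b) (β κ e) y (t ℤ.* M) M eq (ℤ.*-monoʳ-≤-nonNeg M t≤0) e≤y y<b)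
        where
        arith : ∀ b e y tm m → b ℤ.- e ≡ tm → tm ℤ.≤ 0ℤ ℤ.* m → e ℤ.≤ y → 1ℤ ℤ.+ y ℤ.≤ b → 1ℤ ℤ.≤ 0ℤ
        arith b e y tm m p q r s = lin (ℤ.≤-reflexive p ⊞ q ⊞ r ⊞ s) (solve (b ∷ e ∷ y ∷ tm ∷ m ∷ []))
      go : ∀ t → β κ b ℤ.- β κ e ≡ t ℤ.* M → _
      go ℤ.-[1+ t ]  eq = ⊥-elim (absurd ℤ.-[1+ t ] ℤ.-≤+ eq)
      go (+ zero)    eq = ⊥-elim (absurd 0ℤ ℤ.≤-refl eq)
      go (+ (suc t)) eq with bead-or-gap κ symm (M ℤ.- β κ b)
      -- The bead `1 + β κ b - 2n`, lowered by `2n` another `t` times, lands on `1 + β κ e`.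
      ... | inj₂ (d , eq′) with f , eq″ ← beads-down core-before d t =
            ⊥-elim (next-free {e} {f} a′ (arith (β κ b) (β κ e) (β κ d) (β κ f) (+ t) M eq eq′ eq″))
        where
        arith : ∀ b e d f t m → b ℤ.- e ≡ (1ℤ ℤ.+ t) ℤ.* m → d ≡ 1ℤ ℤ.- (m ℤ.- b) → f ≡ d ℤ.- t ℤ.* m → f ≡ 1ℤ ℤ.+ e
        arith b e d f t m p refl refl = lin≡ p (solve (b ∷ e ∷ t ∷ m ∷ []))
      -- `2n - β κ b` is `- β κ e` lowered by `t` times `2n`, hence at most `y` and below `β κ b`,
      -- so its row comes after `b`.
      ... | inj₁ (j , eq′) = h≡ , β-reflects-< κ (arith₃ (β κ b) (β κ e) (β κ (height n κ b)) y (+ t) M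
              eq (ℤ.*-monoʳ-≤-nonNeg M (+≤+ {0} {t} z≤n)) h≡ -e≤y y<b)
        where
        open Cut (height-cut n κ b)
        arith₁ : ∀ b j m → j ≡ m ℤ.- b → 1ℤ ℤ.+ j ℤ.≤ 1ℤ ℤ.+ m ℤ.- b
        arith₁ b j m refl = lin (ℤ.≤-refl {b}) (solve (b ∷ m ∷ []))
        arith₂ : ∀ b x m → 1ℤ ℤ.+ x ℤ.≤ 1ℤ ℤ.+ m ℤ.- b → x ℤ.≤ m ℤ.- b
        arith₂ b x m p = lin p (solve (b ∷ x ∷ m ∷ []))
        h≡ : β κ (height n κ b) ≡ M ℤ.- β κ b
        h≡ = ℤ.≤-antisym (arith₂ (β κ b) (β κ (height n κ b)) M at)
          (ℤ.≤-trans (ℤ.≤-reflexive (sym eq′)) (β-mono κ (cut-≥ (height-cut n κ b) (arith₁ (β κ b) (β κ j) M eq′))))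
        arith₃ : ∀ b e h y t m → b ℤ.- e ≡ (1ℤ ℤ.+ t) ℤ.* m → 0ℤ ℤ.* m ℤ.≤ t ℤ.* m → h ≡ m ℤ.- b → ℤ.- e ℤ.≤ y →
                 1ℤ ℤ.+ y ℤ.≤ b → 1ℤ ℤ.+ h ℤ.≤ b
        arith₃ b e h y t m p q refl r s = lin (ℤ.≤-reflexive (sym p) ⊞ q ⊞ r ⊞ s) (solve (b ∷ e ∷ y ∷ t ∷ m ∷ []))

    -- `β κ b` is congruent to `y` or to `- y`, and both are contents of moved beads, those of row
    -- `a` and of its `opposite`; maximality of `a` makes `β κ b` larger than `y`.
    other-blocked : ∀ {b} → Upper b → b ≢ a → β κ (height n κ b) ≡ M ℤ.- β κ b × b < height n κ b
    other-blocked {b} u@(a′ , _) b≢a = [ congruent-below Aa ℤ.≤-refl -y≤y y<b , opposite-congruent ]′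
        (residue-congruent {n} {i} (residue Aa) (residue a′))
      where
      0≤y : 0ℤ ℤ.≤ y
      0≤y = proj₂ (proj₁ a-max)
      -y≤y : ℤ.- y ℤ.≤ y
      -y≤y = ℤ.≤-trans (ℤ.neg-mono-≤ 0≤y) 0≤y
      y<b : 1ℤ ℤ.+ y ℤ.≤ β κ b
      y<b = β-anti κ (≤∧≢⇒< (proj₂ a-max b u) b≢a)
      opposite-congruent : ∃[ t ] β κ b ℤ.- ℤ.- y ≡ t ℤ.* M → _
      opposite-congruent (t , eq) with e , a″ , e≡ ← opposite Aa =
        congruent-below a″ (subst (ℤ._≤ y) (sym e≡) -y≤y)
          (ℤ.≤-reflexive (trans (cong ℤ.-_ e≡) (ℤ.neg-involutive y))) y<b
          (t , trans (cong (λ x → β κ b ℤ.- x) e≡) eq)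

    𝔭-part-max : 𝔭-part n κ′ a ≡ suc (𝔭-part n κ a)
    𝔭-part-max = trans (cong₂ (λ x m → suc x ∸ m) (part-moved Aa) max≡)
        -- The case `y = 0` is included: there `𝔭-part n κ a` is 0 and the new diagonal box makes it
        -- 1.
        (+-∸-assoc 1 (⊔-lub (s≤s (0≤β⇒≤part κ (proj₂ (proj₁ a-max)))) (m≤n⇒m≤1+n (height≤part n κ symm a))))
      where
      max≡ : suc a ⊔ height n κ′ a ≡ suc a ⊔ height n κ a
      max≡ with β κ (height n κ a) ℤ.≟ M ℤ.- y
      ... | no neq = cong (suc a ⊔_) (height-free Aa neq)
      ... | yes eq = trans (cong (suc a ⊔_) (height-blocked Aa eq))
              (trans (m≥n⇒m⊔n≡m (s≤s h≤a)) (sym (m≥n⇒m⊔n≡m (m≤n⇒m≤1+n h≤a))))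
        where
        h≤a : height n κ a ≤ a
        h≤a = max-not-blocked eq

    𝔭-part-other : ∀ {b} → b ≢ a → 𝔭-part n κ′ b ≡ 𝔭-part n κ b
    𝔭-part-other {b} b≢a with in-move? b
    ... | no ¬a′ = cong₂ (λ x h → suc x ∸ (suc b ⊔ h)) (part-fixed ¬a′) (height-fixed ¬a′)
    ... | yes a′ with 0ℤ ℤ.≤? β κ b
    ...   | yes 0≤ with eq , b<h ← other-blocked (a′ , 0≤) b≢a =
            trans (cong₂ (λ x h → suc x ∸ (suc b ⊔ h)) (part-moved a′) (height-blocked a′ eq))
              (cong (suc (part κ b) ∸_) (trans (m≤n⇒m⊔n≡n (<⇒≤ b<h)) (sym (m≤n⇒m⊔n≡n b<h))))
    -- A negative content means `part κ b < b`, so even with the new box the row does not cross the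
    -- diagonal and both values are 0.
    ...   | no  0≰ = trans (zero-part κ′ (≤-trans (≤-reflexive (part-moved a′)) part<b)) (sym (zero-part κ (<⇒≤ part<b)))
      where
      part<b : part κ b < b
      part<b = ≰⇒> (0≰ ∘ ≤part⇒0≤β κ)
      zero-part : ∀ κ → part κ b ≤ b → 𝔭-part n κ b ≡ 0
      zero-part κ part≤b = m≤n⇒m∸n≡0 (≤-trans (s≤s part≤b) (m≤m⊔n (suc b) (height n κ b)))

-- The action of s i

1+-injective : ∀ {x y} → 1ℤ ℤ.+ x ≡ 1ℤ ℤ.+ y → x ≡ y
1+-injective {x} {y} p = lin≡ p (solve (x ∷ y ∷ []))

module _ (n i : ℕ) where

  private
    M : ℤ
    M = + (2 * n)

  HasResidue±⇒ : ∀ b → HasResidue± n i b → Residue± n (+ i) (content b)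
  HasResidue±⇒ b (inj₁ p) with Signed.∣ᵤ⇒∣ {M} {content b ℤ.- + i} p
  ... | Signed.divides q eq = q , inj₁ (arith (content b) (+ i) (q ℤ.* M) eq)
    where
    arith : ∀ x i qm → x ℤ.- i ≡ qm → x ≡ qm ℤ.+ i
    arith x i qm refl = solve (x ∷ i ∷ [])
  HasResidue±⇒ b (inj₂ p) with Signed.∣ᵤ⇒∣ {M} {content b ℤ.- (M ℤ.- + i)} p
  ... | Signed.divides q eq = q ℤ.+ 1ℤ , inj₂ (arith (content b) (+ i) q M eq)
    where
    arith : ∀ x i q m → x ℤ.- (m ℤ.- i) ≡ q ℤ.* m → x ≡ (q ℤ.+ 1ℤ) ℤ.* m ℤ.- i
    arith x i q m p = lin≡ p (solve (x ∷ i ∷ q ∷ m ∷ []))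

  HasResidue±⇐ : ∀ b → Residue± n (+ i) (content b) → HasResidue± n i b
  HasResidue±⇐ b (t , inj₁ p) = inj₁ (Signed.∣⇒∣ᵤ {M} {content b ℤ.- + i}
      (Signed.divides t (arith (content b) (+ i) (t ℤ.* M) p)))
    where
    arith : ∀ x i tm → x ≡ tm ℤ.+ i → x ℤ.- i ≡ tm
    arith x i tm refl = solve (tm ∷ i ∷ [])
  HasResidue±⇐ b (t , inj₂ p) = inj₂ (Signed.∣⇒∣ᵤ {M} {content b ℤ.- (M ℤ.- + i)}
      (Signed.divides (t ℤ.- 1ℤ) (arith (content b) (+ i) t M p)))
    where
    arith : ∀ x i t m → x ≡ t ℤ.* m ℤ.- i → x ℤ.- (m ℤ.- i) ≡ (t ℤ.- 1ℤ) ℤ.* m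
    arith x i t m refl = solve (t ∷ i ∷ m ∷ [])

  -- Reflection exchanges the residues `i` and `- i`; `k = 0` serves transposition, `k = 1` two
  -- contents with sum `2n`.
  reflect-residue : ∀ {x y} k → x ℤ.+ y ≡ k ℤ.* M → Residue± n (+ i) x → Residue± n (+ i) y
  reflect-residue {x} {y} k eq (t , inj₁ p) = k ℤ.- t , inj₂ (arith x y (+ i) k t M eq p)
    where
    arith : ∀ x y i k t m → x ℤ.+ y ≡ k ℤ.* m → x ≡ t ℤ.* m ℤ.+ i → y ≡ (k ℤ.- t) ℤ.* m ℤ.- i
    arith x y i k t m p refl = lin≡ p (solve (y ∷ i ∷ k ∷ t ∷ m ∷ []))
  reflect-residue {x} {y} k eq (t , inj₂ p) = k ℤ.- t , inj₁ (arith x y (+ i) k t M eq p)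
    where
    arith : ∀ x y i k t m → x ℤ.+ y ≡ k ℤ.* m → x ≡ t ℤ.* m ℤ.- i → y ≡ (k ℤ.- t) ℤ.* m ℤ.+ i
    arith x y i k t m p refl = lin≡ p (solve (y ∷ i ∷ k ∷ t ∷ m ∷ []))

  HasResidue±-transpose : ∀ r c → HasResidue± n i (r , c) → HasResidue± n i (c , r)
  HasResidue±-transpose r c p = HasResidue±⇐ (c , r) (reflect-residue 0ℤ (arith (+ r) (+ c) M) (HasResidue±⇒ (r , c) p))
    where
    arith : ∀ r c m → c ℤ.- r ℤ.+ (r ℤ.- c) ≡ 0ℤ ℤ.* m
    arith r c m = solve (r ∷ c ∷ m ∷ [])

-- Corners of symmetric partitions

module _ (κ : Partition) (symm : Symmetric κ) where

  CanAdd-transpose : ∀ {r} → CanAdd κ r → CanAdd κ (part κ r) × r ≡ part κ (part κ r)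
  CanAdd-transpose {r} can = can-add (part κ r) refl , ≤-antisym (r≤ r can refl) (≮⇒≥ (<-irrefl refl ∘ symm))
    where
    r≤ : ∀ r → CanAdd κ r → ∀ {c} → c ≡ part κ r → r ≤ part κ c
    r≤ zero    _   _    = z≤n
    r≤ (suc r) can refl = symm can
    can-add : ∀ c → c ≡ part κ r → CanAdd κ c
    can-add zero    _  = _
    can-add (suc c) eq = ≤-<-trans (≮⇒≥ λ r< → <-irrefl eq (symm r<)) (symm (≤-reflexive eq))

  CanRemove-transpose : ∀ {r c} → CanRemove κ r → suc c ≡ part κ r → CanRemove κ c × suc r ≡ part κ c
  CanRemove-transpose {r} {c} can eq = ≤-<-trans part≤r r<part , ≤-antisym r<part (≮⇒≥ part≤suc-r)
    where
    r<part : r < part κ c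
    r<part = symm (≤-reflexive eq)
    part≤r : part κ (suc c) ≤ r
    part≤r = ≮⇒≥ λ r< → <-irrefl eq (symm r<)
    part≤suc-r : ¬ (suc r < part κ c)
    part≤suc-r p = <⇒≱ (<-≤-trans can (≤-reflexive (sym eq))) (symm p)

  Addable-transpose : ∀ {r c} → Addable κ (r , c) → Addable κ (c , r)
  Addable-transpose add with can , refl ← Addable⇒ κ add = Addable⇐ κ (CanAdd-transpose can)

  Removable-transpose : ∀ {r c} → Removable κ (r , c) → Removable κ (c , r)
  Removable-transpose rem with can , eq ← Removable⇒ κ rem = Removable⇐ κ (CanRemove-transpose can eq)

opaque
  unfolding β

  β-content : ∀ κ r → β κ r ≡ content (r , part κ r)
  β-content κ r = refl

  -- Neighbouring rows of equal length have consecutive beads, so a free next place forces a strict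
  -- drop.
  next-free⇒CanAdd : ∀ κ c → (∀ d → β κ d ≢ 1ℤ ℤ.+ β κ c) → CanAdd κ c
  next-free⇒CanAdd κ zero    _    = _
  next-free⇒CanAdd κ (suc c) free = ≤∧≢⇒< (part-antitone κ c) λ eq → free c
    (trans (cong (λ x → + x ℤ.- + c) (sym eq)) (arith (+ part κ (suc c)) (+ c)))
    where
    arith : ∀ x c → x ℤ.- c ≡ 1ℤ ℤ.+ (x ℤ.- (1ℤ ℤ.+ c))
    arith x c = solve (x ∷ c ∷ [])

  previous-free⇒CanRemove : ∀ κ c → (∀ d → 1ℤ ℤ.+ β κ d ≢ β κ c) → CanRemove κ c
  previous-free⇒CanRemove κ c free = ≤∧≢⇒< (part-antitone κ c) λ eq → free (suc c)
    (trans (arith (+ part κ (suc c)) (+ c)) (cong (λ x → + x ℤ.- + c) eq))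
    where
    arith : ∀ x c → 1ℤ ℤ.+ (x ℤ.- (1ℤ ℤ.+ c)) ≡ x ℤ.- c
    arith x c = solve (x ∷ c ∷ [])

-- κ′ is an argument of its own, so that s n i κ need not be unfolded.
Claim : (n i : ℕ) (lam κ κ′ : Partition) → Set
Claim n i lam κ κ′ =
  (dg κ ⊂ dg κ′ → ∃[ a ] (IsMax (AddableRow n i κ) a × (∃[ μ ] (seq μ ≗ (seq lam ⊕ ε a) × BoundedPartition n μ × 𝔭⁻¹-of n μ κ′))))
  × (dg κ ⊃ dg κ′ → ∃[ r ] (IsMax (RemovableRow n i κ) r × (∃[ μ ] (seq μ ≗ (seq lam ⊖ ε r) × BoundedPartition n μ × 𝔭⁻¹-of n μ κ′))))
  × (¬ (dg κ ⊂ dg κ′) → ¬ (dg κ ⊃ dg κ′) → κ′ ≡ κ)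

-- The action preserves symmetric cores

module _ {n : ℕ} (i : ℕ) {κ : Partition} (κ-core : Core n κ) where
  open Core κ-core

  private
    M : ℤ
    M = + (2 * n)

  module _ (κ′ : Partition) (dg′ : dg κ′ ≐ (dg κ ∪ (Addable κ ∩ HasResidue± n i))) where

    Added : Pred ℕ 0ℓ
    Added r = CanAdd κ r × HasResidue± n i (r , part κ r)

    added-move : Move κ κ′ Added
    added-move r with CanAdd? κ r ×-dec HasResidue±? n i (r , part κ r)
    ... | yes (can , res) = inj₁ ((can , res) , ≤-antisym (≮⇒≥ not-two) (proj₂ dg′ {r , part κ r} (inj₂ (Addable⇐ κ (can , refl) , res))))
      where
      not-two : ¬ (suc (part κ r) < part κ′ r)
      not-two p with proj₁ dg′ {r , suc (part κ r)} p
      ... | inj₁ q         = <⇒≱ q (n≤1+n _)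
      ... | inj₂ (add , _) = 1+n≢n (proj₂ (Addable⇒ κ add))
    ... | no ¬added = inj₂ (¬added , ≤-antisym (≮⇒≥ not-more) (≮⇒≥ λ p → <-irrefl refl (proj₂ dg′ {r , part κ′ r} (inj₁ p))))
      where
      not-more : ¬ (part κ r < part κ′ r)
      not-more p with proj₁ dg′ {r , part κ r} p
      ... | inj₁ q           = <-irrefl refl q
      ... | inj₂ (add , res) = ¬added (proj₁ (Addable⇒ κ add) , res)

    open Moves κ κ′ added-move

    added-residue : ∀ {r} → Added r → Residue± n (+ i) (β κ r)
    added-residue {r} (_ , res) = subst (Residue± n (+ i)) (sym (β-content κ r)) (HasResidue±⇒ n i (r , part κ r) res)

    added-symmetric : Symmetric κ′
    added-symmetric {r} {c} p with proj₁ dg′ {r , c} p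
    ... | inj₁ q           = proj₂ dg′ {c , r} (inj₁ (symm q))
    ... | inj₂ (add , res) = proj₂ dg′ {c , r} (inj₂ (Addable-transpose κ symm add , HasResidue±-transpose n i r c res))

    -- A bead just above that of row `c` would have sum `1 + 2n` with row `r`, so row `c` can grow;
    -- its residue is the reflection of that of row `r`.
    added-mirror : ∀ {r c} → Added r → β κ r ℤ.+ β κ c ≡ M → Added c
    added-mirror {r} {c} a eq =
        next-free⇒CanAdd κ c (λ d eq′ → no-hook r d (arith (β κ r) (β κ c) (β κ d) M eq eq′)) ,
        HasResidue±⇐ n i (c , part κ c) (subst (Residue± n (+ i)) (β-content κ c)
          (reflect-residue n i 1ℤ (trans eq (sym (ℤ.*-identityˡ M))) (added-residue a)))
      where
      arith : ∀ r c d m → r ℤ.+ c ≡ m → d ≡ 1ℤ ℤ.+ c → r ℤ.+ d ≡ 1ℤ ℤ.+ m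
      arith r c d m refl refl = solve (r ∷ c ∷ [])

    -- Before the addition the sum was `2n - 1`, `2n` or `1 + 2n`, according to whether two, one or
    -- none of the beads moved; parity, `added-mirror` and `no-hook` exclude these in turn.
    added-no-hook : ∀ r c → β κ′ r ℤ.+ β κ′ c ≢ 1ℤ ℤ.+ M
    added-no-hook r c eq with in-move? r | in-move? c
    ... | yes a | yes a′ = residue-sum-even {n} {+ i} (added-residue a) (added-residue a′) (+ n ℤ.- 1ℤ)
          (arith (β κ r ℤ.+ β κ c) M (+ n) (+2n n) (trans (sym (sum-moved-moved a a′)) eq))
      where
      arith : ∀ x m n → m ≡ n ℤ.+ n → + 2 ℤ.+ x ≡ 1ℤ ℤ.+ m → x ≡ 1ℤ ℤ.+ (n ℤ.- 1ℤ ℤ.+ (n ℤ.- 1ℤ))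
      arith x m n refl p = lin≡ p (solve (x ∷ n ∷ []))
    ... | yes a | no ¬a′ = ¬a′ (added-mirror a (1+-injective (trans (sym (sum-moved-fixed a ¬a′)) eq)))
    ... | no ¬a | yes a′ = ¬a (added-mirror a′ (1+-injective (trans (sym (sum-moved-fixed a′ ¬a)) (trans (ℤ.+-comm (β κ′ c) (β κ′ r)) eq))))
    ... | no ¬a | no ¬a′ = no-hook r c (trans (sym (sum-fixed-fixed ¬a ¬a′)) eq)

    added-core : Core n κ′
    added-core = core added-symmetric added-no-hook

    added-step : Step n (+ i) κ κ′ Added
    added-step = record { core-before = κ-core ; core-after = added-core ; move = added-move ; residue = added-residue }

  module _ (κ′ : Partition) (dg′ : dg κ′ ≐ (dg κ ∖ (Removable κ ∩ HasResidue± n i))) where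

    Removed : Pred ℕ 0ℓ
    Removed r = CanRemove κ r × HasResidue± n i (r , pred (part κ r))

    removed-move : Move κ′ κ Removed
    removed-move r with CanRemove? κ r ×-dec HasResidue±? n i (r , pred (part κ r))
    ... | yes (can , res) = inj₁ ((can , res) , trans (sym suc-pred-part) (cong suc (≤-antisym (≮⇒≥ not-less) (≮⇒≥ removed))))
      where
      suc-pred-part : suc (pred (part κ r)) ≡ part κ r
      suc-pred-part = suc-pred (part κ r) {{>-nonZero (≤-<-trans z≤n can)}}
      removed : ¬ (pred (part κ r) < part κ′ r)
      removed p = proj₂ (proj₁ dg′ {r , pred (part κ r)} p) (Removable⇐ κ (can , suc-pred-part) , res)
      not-less : ¬ (part κ′ r < pred (part κ r))
      not-less p = <-irrefl refl (proj₂ dg′ {r , part κ′ r} (<-≤-trans p pred[n]≤n ,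
        λ (rem , _) → <-irrefl (cong pred (proj₂ (Removable⇒ κ rem))) p))
    ... | no ¬removed = inj₂ (¬removed , ≤-antisym (≮⇒≥ not-less) (≮⇒≥ λ p → <-irrefl refl (proj₁ (proj₁ dg′ {r , part κ r} p))))
      where
      not-less : ¬ (part κ′ r < part κ r)
      not-less p = <-irrefl refl (proj₂ dg′ {r , part κ′ r} (p , λ (rem , res) →
        let can , eq = Removable⇒ κ rem in ¬removed (can , subst (λ c → HasResidue± n i (r , c)) (cong pred eq) res)))

    open Moves κ′ κ removed-move

    removed-residue : ∀ {r} → Removed r → Residue± n (+ i) (β κ′ r)
    removed-residue {r} a@(_ , res) = subst (Residue± n (+ i))
      (trans (cong (λ c → content (r , pred c)) (part-moved a)) (sym (β-content κ′ r))) (HasResidue±⇒ n i (r , pred (part κ r)) res)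

    removed-symmetric : Symmetric κ′
    removed-symmetric {r} {c} p with q , not ← proj₁ dg′ {r , c} p =
      proj₂ dg′ {c , r} (symm q , λ (rem , res) → not (Removable-transpose κ symm rem , HasResidue±-transpose n i c r res))

    -- A bead just below that of row `c` would have sum `1 + 2n` with row `r` in `κ`, so row `c` has
    -- a removable corner. Its content `β κ c - 1` and `β κ′ r` sum to `2n`.
    removed-mirror : ∀ {r c} → Removed r → β κ′ r ℤ.+ β κ c ≡ 1ℤ ℤ.+ M → Removed c
    removed-mirror {r} {c} a eq = can , HasResidue±⇐ n i (c , pred (part κ c)) (reflect-residue n i 1ℤ
        (trans (cong (ℤ._+_ (β κ′ r)) content≡) (arith₂ (β κ′ r) (β κ c) M eq)) (removed-residue a))
      where
      arith₁ : ∀ r r′ c d m → r′ ≡ 1ℤ ℤ.+ r → r ℤ.+ c ≡ 1ℤ ℤ.+ m → 1ℤ ℤ.+ d ≡ c → r′ ℤ.+ d ≡ 1ℤ ℤ.+ m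
      arith₁ r r′ c d m refl p refl = lin≡ p (solve (r ∷ d ∷ m ∷ []))
      arith₂ : ∀ r c m → r ℤ.+ c ≡ 1ℤ ℤ.+ m → r ℤ.+ (c ℤ.- 1ℤ) ≡ 1ℤ ℤ.* m
      arith₂ r c m p = lin≡ p (solve (r ∷ c ∷ m ∷ []))
      can : CanRemove κ c
      can = previous-free⇒CanRemove κ c (λ d eq′ → no-hook r d
        (arith₁ (β κ′ r) (β κ r) (β κ c) (β κ d) M (β-moved a) eq eq′))
      content≡ : content (c , pred (part κ c)) ≡ β κ c ℤ.- 1ℤ
      content≡ = trans (arith₃ (+ pred (part κ c)) (+ c))
        (cong (ℤ._- 1ℤ) (trans (cong (λ x → + x ℤ.- + c) (suc-pred (part κ c) {{>-nonZero (≤-<-trans z≤n can)}})) (sym (β-content κ c))))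
        where
        arith₃ : ∀ x c → x ℤ.- c ≡ (1ℤ ℤ.+ x) ℤ.- c ℤ.- 1ℤ
        arith₃ x c = solve (x ∷ c ∷ [])

    -- Two lowered beads cannot have an odd sum; if just one was lowered, `removed-mirror` would
    -- make the other a lowered one too.
    removed-no-hook : ∀ r c → β κ′ r ℤ.+ β κ′ c ≢ 1ℤ ℤ.+ M
    removed-no-hook r c eq with in-move? r | in-move? c
    ... | yes a | yes a′ = residue-sum-even {n} {+ i} (removed-residue a) (removed-residue a′) (+ n)
          (trans eq (cong (ℤ._+_ 1ℤ) (+2n n)))
    ... | yes a | no ¬a′ = ¬a′ (removed-mirror a (trans (cong (ℤ._+_ (β κ′ r)) (β-fixed ¬a′)) eq))
    ... | no ¬a | yes a′ = ¬a (removed-mirror a′ (trans (cong (ℤ._+_ (β κ′ c)) (β-fixed ¬a)) (trans (ℤ.+-comm (β κ′ c) (β κ′ r)) eq)))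
    ... | no ¬a | no ¬a′ = no-hook r c (trans (sum-fixed-fixed ¬a ¬a′) eq)

    removed-core : Core n κ′
    removed-core = core removed-symmetric removed-no-hook

    removed-step : Step n (+ i) κ′ κ Removed
    removed-step = record { core-before = removed-core ; core-after = κ-core ; move = removed-move ; residue = removed-residue }

-- Assembling the three cases

IsMax-≐ : ∀ {P Q : Pred ℕ 0ℓ} → P ≐ Q → ∀ {m} → IsMax P m → IsMax Q m
IsMax-≐ (to , from) (Pm , max) = to Pm , λ c Qc → max c (from Qc)

ε-diagonal : ∀ a → ε a a ≡ 1ℤ
ε-diagonal a with a ≟ a
... | yes _  = refl
... | no a≢a = ⊥-elim (a≢a refl)

ε-off-diagonal : ∀ {a j} → a ≢ j → ε a j ≡ 0ℤ
ε-off-diagonal {a} {j} a≢j with a ≟ j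
... | yes a≡j = ⊥-elim (a≢j a≡j)
... | no _    = refl

part-image : ∀ {n lam κ} → Symmetric κ → 𝔭 n κ ≡ parts lam → ∀ j → part lam j ≡ 𝔭-part n κ j
part-image {n} {κ = κ} symm image j = trans (cong (λ xs → nth xs j) (sym image)) (nth-𝔭 n κ symm j)

𝔭-partition-of : ∀ {n κ} (κ-core : Core n κ) → 𝔭⁻¹-of n (𝔭-partition κ-core) κ
𝔭-partition-of κ-core = record { symmetric-core = Core⇒SymmetricCore κ-core ; image = refl }

step-seq : ∀ {n i κ κ′ A a lam lam′} (step : Step n i κ κ′ A) → 1 ≤ n → IsMax (Upper step) a →
           𝔭 n κ ≡ parts lam → 𝔭 n κ′ ≡ parts lam′ → seq lam′ ≗ (seq lam ⊕ ε a)
step-seq {n} {κ = κ} {κ′} {a = a} {lam} {lam′} step 1≤n a-max image image′ j =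
  trans (cong +_ (part-image {lam = lam′} (Core.symm (Step.core-after step)) image′ j))
    (trans (entry (a ≟ j)) (cong (λ x → + x ℤ.+ ε a j) (sym (part-image {lam = lam} (Core.symm (Step.core-before step)) image j))))
  where
  entry : Dec (a ≡ j) → + 𝔭-part n κ′ j ≡ + 𝔭-part n κ j ℤ.+ ε a j
  entry (yes refl) = trans (cong +_ (𝔭-part-max step 1≤n a-max))
    (trans (ℤ.+-comm 1ℤ (+ 𝔭-part n κ a)) (cong (ℤ._+_ (+ 𝔭-part n κ a)) (sym (ε-diagonal a))))
  entry (no a≢j)   = trans (cong +_ (𝔭-part-other step 1≤n a-max (a≢j ∘ sym)))
    (trans (sym (ℤ.+-identityʳ _)) (cong (ℤ._+_ (+ 𝔭-part n κ j)) (sym (ε-off-diagonal a≢j))))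

claim-fix : ∀ {n i lam κ} → Claim n i lam κ κ
claim-fix = (λ (_ , κ⊈κ) → ⊥-elim (κ⊈κ λ p → p)) , (λ (_ , κ⊈κ) → ⊥-elim (κ⊈κ λ p → p)) , λ _ _ → refl

module _ {n i : ℕ} {lam κ κ′ : Partition} (1≤n : 1 ≤ n) (κ-core : Core n κ) (image : 𝔭 n κ ≡ parts lam) where

  -- The corner `b` makes the inclusion strict, so the other two cases of the claim are vacuous.
  claim-add : dg κ′ ≐ (dg κ ∪ (Addable κ ∩ HasResidue± n i)) →
              ∃[ b ] Addable κ b × HasResidue± n i b → Claim n i lam κ κ′
  claim-add dg′ (b , add , res) =
      (λ _ → a , IsMax-≐ upper≐ a-max , 𝔭-partition core′ ,
        step-seq {lam = lam} {𝔭-partition core′} step 1≤n a-max image refl , 𝔭-bounded core′ 1≤n , 𝔭-partition-of core′)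
    , (λ (⊆κ , _) → ⊥-elim (proj₁ add (⊆κ {b} (proj₂ dg′ {b} (inj₂ (add , res))))))
    , (λ ¬⊂ _ → ⊥-elim (¬⊂ ((λ {x} p → proj₂ dg′ {x} (inj₁ p)) , λ ⊆κ → proj₁ add (⊆κ {b} (proj₂ dg′ {b} (inj₂ (add , res)))))))
    where
    step = added-step i κ-core κ′ dg′
    core′ = Step.core-after step
    added : Added i κ-core κ′ dg′ (proj₁ b)
    added with can , eq ← Addable⇒ κ add = can , subst (λ c → HasResidue± n i (proj₁ b , c)) eq res
    a = proj₁ (upper-max step added)
    a-max = proj₂ (upper-max step added)
    upper≐ : Upper step ≐ AddableRow n i κ
    upper≐ = (λ { {c} ((can , res) , 0≤) → part κ c , Addable⇐ κ (can , refl) , res , subst (0ℤ ℤ.≤_) (β-content κ c) 0≤ })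
           , (λ { {c} (d , add , res , 0≤) → from d (Addable⇒ κ add) res 0≤ })
      where
      from : ∀ {c} d → CanAdd κ c × d ≡ part κ c → HasResidue± n i (c , d) → 0ℤ ℤ.≤ content (c , d) → Upper step c
      from {c} _ (can , refl) res 0≤ = (can , res) , subst (0ℤ ℤ.≤_) (sym (β-content κ c)) 0≤

  claim-remove : dg κ′ ≐ (dg κ ∖ (Removable κ ∩ HasResidue± n i)) →
                 ∃[ b ] Removable κ b × HasResidue± n i b → Claim n i lam κ κ′
  claim-remove dg′ (b , rem , res) =
      (λ (κ⊆ , _) → ⊥-elim (proj₂ (proj₁ dg′ {b} (κ⊆ {b} (proj₁ rem))) (rem , res)))
    , (λ _ → a , IsMax-≐ upper≐ a-max , 𝔭-partition core′ , seq≗ , 𝔭-bounded core′ 1≤n , 𝔭-partition-of core′)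
    , (λ _ ¬⊃ → ⊥-elim (¬⊃ ((λ {x} p → proj₁ (proj₁ dg′ {x} p)) , λ κ⊆ → proj₂ (proj₁ dg′ {b} (κ⊆ {b} (proj₁ rem))) (rem , res))))
    where
    step = removed-step i κ-core κ′ dg′
    -- The step runs from `κ′` up to `κ`, so the new core is its lower end.
    core′ = Step.core-before step
    removed : Removed i κ-core κ′ dg′ (proj₁ b)
    removed with can , eq ← Removable⇒ κ rem = can , subst (λ c → HasResidue± n i (proj₁ b , c)) (cong pred eq) res
    a = proj₁ (upper-max step removed)
    a-max = proj₂ (upper-max step removed)
    seq≗ : seq (𝔭-partition core′) ≗ (seq lam ⊖ ε a)
    -- `step-seq` gives the old sequence as the new one plus `ε a`; this is solved for the new one.
    seq≗ j = arith (seq (𝔭-partition core′) j) (seq lam j) (ε a j)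
      (step-seq {lam = 𝔭-partition core′} {lam} step 1≤n a-max refl image j)
      where
      arith : ∀ x y e → y ≡ x ℤ.+ e → x ≡ y ℤ.- e
      arith x y e refl = solve (x ∷ e ∷ [])
    content≡ : ∀ {c d} → Removed i κ-core κ′ dg′ c → suc d ≡ part κ c → content (c , d) ≡ β κ′ c
    content≡ {c} {d} r eq = trans
      (cong (λ d → content (c , d)) (suc-injective (trans eq (Moves.part-moved κ′ κ (removed-move i κ-core κ′ dg′) r))))
      (sym (β-content κ′ c))
    upper≐ : Upper step ≐ RemovableRow n i κ
    upper≐ = (λ { {c} (r@(can , res) , 0≤) →
                   let eq = suc-pred (part κ c) {{>-nonZero (≤-<-trans z≤n can)}} in
                   pred (part κ c) , Removable⇐ κ (can , eq) , res , subst (0ℤ ℤ.≤_) (sym (content≡ r eq)) 0≤ })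
           , (λ { {c} (d , rem , res , 0≤) → from d (Removable⇒ κ rem) res 0≤ })
      where
      from : ∀ {c} d → CanRemove κ c × suc d ≡ part κ c → HasResidue± n i (c , d) → 0ℤ ℤ.≤ content (c , d) → Upper step c
      from {c} d (can , eq) res 0≤ = r , subst (0ℤ ℤ.≤_) (content≡ r eq) 0≤
        where
        r = can , subst (λ c′ → HasResidue± n i (c , c′)) (cong pred eq) res

-- A corner of residue `i` is in particular one of residue `±i`, so in the first two cases the set
-- of moved corners is inhabited.
s-cases : ∀ n i κ →
  (dg (s n i κ) ≐ (dg κ ∪ (Addable κ ∩ HasResidue± n i)) × ∃[ b ] Addable κ b × HasResidue± n i b)
  ⊎ (dg (s n i κ) ≐ (dg κ ∖ (Removable κ ∩ HasResidue± n i)) × ∃[ b ] Removable κ b × HasResidue± n i b)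
  ⊎ s n i κ ≡ κ
s-cases n i κ with someAddable? κ (HasResidue? n (+ i)) | someRemovable? κ (HasResidue? n (+ i))
... | yes (b , add , res) | _ = inj₁ (proj₂ (addCorners κ (HasResidue±? n i)) , b , add , inj₁ res)
... | no _ | yes (b , rem , res) = inj₂ (inj₁ (proj₂ (removeCorners κ (HasResidue±? n i)) , b , rem , inj₁ res))
... | no _ | no _ = inj₂ (inj₂ refl)

theorem4p4 : ∀ (n i : ℕ) (lam κ : Partition) → 2 ≤ n → i ≤ n → BoundedPartition n lam → 𝔭⁻¹-of n lam κ →
    (dg κ ⊂ dg (s n i κ) → ∃[ a ] (IsMax (AddableRow n i κ) a × (∃[ μ ] (seq μ ≗ (seq lam ⊕ ε a) × BoundedPartition n μ × 𝔭⁻¹-of n μ (s n i κ)))))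
    × (dg κ ⊃ dg (s n i κ) → ∃[ r ] (IsMax (RemovableRow n i κ) r × (∃[ μ ] (seq μ ≗ (seq lam ⊖ ε r) × BoundedPartition n μ × 𝔭⁻¹-of n μ (s n i κ)))))
    × (¬ (dg κ ⊂ dg (s n i κ)) → ¬ (dg κ ⊃ dg (s n i κ)) → s n i κ ≡ κ)
theorem4p4 n i lam κ 2≤n _ _ lam↦κ = prove (s-cases n i κ)
  where
  1≤n : 1 ≤ n
  1≤n = <⇒≤ 2≤n
  κ-core : Core n κ
  κ-core = SymmetricCore⇒Core (𝔭⁻¹-of.symmetric-core lam↦κ)
  image : 𝔭 n κ ≡ parts lam
  image = 𝔭⁻¹-of.image lam↦κ
  prove : _ → Claim n i lam κ (s n i κ)
  prove (inj₁ (dg′ , b))        = claim-add {n} {i} {lam} 1≤n κ-core image dg′ b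
  prove (inj₂ (inj₁ (dg′ , b))) = claim-remove {n} {i} {lam} 1≤n κ-core image dg′ b
  prove (inj₂ (inj₂ eq))        = subst (Claim n i lam κ) (sym eq) (claim-fix {n} {i} {lam})
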